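{- Let $p$ be a non-negative integer. Let $G$ be a graph and let $G^{(p)}$ be its $p$-subdivision. Then \[\chi(G)^{\frac{1}{p+1}}\leq \chi_{p+1}(G^{(p)})\leq \max(\chi(G),p+2).\]
   Context: All graphs are finite, simple and undirected. The $p$-subdivision $G^{(p)}$ of $G$ is obtained by subdividing each edge by exactly $p$ vertices, i.e. replacing each edge by a path of length $p+1$. $\chi(G)$ is the chromatic number. The tree-depth ${\rm td}(G)$ is the minimum height (number of vertices on a longest root-to-leaf path) of a rooted forest $Y$ such that $G$ is a subgraph of the closure of $Y$ (the graph in which each vertex is adjacent to all its ancestors in $Y$). For a positive integer $q$, $\chi_q(G)$ is the minimum number of colors in a vertex coloring of $G$ such that every set $I$ of at most $q$ colors induces a subgraph of tree-depth at most $|I|$. -}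

module Defs where

open import Data.Bool.Base using (Bool; true; false; T)
open import Data.Fin.Base using (Fin; zero; suc; toℕ; fromℕ<; inject₁)
import Data.Fin.Base as Fin
import Data.Fin.Properties as Fin
open import Data.Fin.Subset using (Subset; ∣_∣; _∈_)
open import Data.Fin.Subset.Properties using (_∈?_; anySubset?)
import Data.List.Base as List
open import Data.List.Extrema.Nat using (max; xs≤max; max≤v⁺)
import Data.List.Relation.Unary.All.Properties as All
open import Data.Maybe.Base using (Maybe; just; nothing; maybe)
import Data.Maybe.Properties as Maybe
open import Data.Nat.Base
open import Data.Nat.Properties hiding (_≟_)
import Data.Nat.Properties as ℕ
open import Data.Product.Base using (Σ; ∃; _×_; _,_; proj₁; proj₂)
open import Data.Product.Function.Dependent.Propositional using (Σ-↔)
open import Data.Product.Function.NonDependent.Propositional using (_×-↔_)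
open import Data.Sum.Base using (_⊎_; inj₁; inj₂; [_,_]′)
import Data.Sum.Base as Sum
open import Data.Sum.Function.Propositional using (_⊎-↔_)
import Data.Sum.Properties as Sum
open import Data.Unit.Base using (tt)
open import Data.Vec.Base using (Vec; []; _∷_; _∷ʳ_; lookup; tabulate)
open import Data.Vec.Properties
  using (lookup∘tabulate; tabulate∘lookup; []=⇒lookup)
open import Function.Base using (id; _∘_; _on_)
open import Function.Bundles using (_↔_; Inverse; mk↔ₛ′)
open import Function.Construct.Composition using (_↔-∘_)
open import Function.Construct.Symmetry using (↔-sym)
open import Function.Definitions using (Injective)
open import Level using (Level; 0ℓ)
open import Relation.Binary.Construct.Closure.Transitive
  using (TransClosure; [_]; _∷_)
open import Relation.Binary.Core using (Rel)
import Relation.Binary.Definitions as B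
open import Relation.Binary.PropositionalEquality
  using (_≡_; _≢_; _≗_; refl; sym; trans; cong; subst)
open import Relation.Nullary.Decidable
  using (Dec; yes; no; True; isYes; toWitness; fromWitness; map′; ¬?; _×-dec_;
         _⊎-dec_; _→-dec_; decidable-stable)
open import Relation.Nullary.Negation using (¬_; contradiction)
open import Relation.Unary using (Decidable)

private
  variable
    ℓ : Level
    A B : Set
    n : ℕ

record Finite (A : Set) : Set where
  field
    size : ℕ
    enum : A ↔ Fin size

  index : A → Fin size
  index = Inverse.to enum

  element : Fin size → A
  element = Inverse.from enum

  element-index : ∀ a → element (index a) ≡ a
  element-index = Inverse.strictlyInverseʳ enum

  index-element : ∀ i → index (element i) ≡ i
  index-element = Inverse.strictlyInverseˡ enum

  index-injective : Injective _≡_ _≡_ index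
  index-injective {a} {b} eq =
    trans (sym (element-index a)) (trans (cong element eq) (element-index b))

  _≟_ : B.DecidableEquality A
  a ≟ b = map′ index-injective (cong index) (index a Fin.≟ index b)

  any? : {P : A → Set ℓ} → Decidable P → Dec (∃ P)
  any? {P = P} P? =
    map′ (λ (i , p) → element i , p)
         (λ (a , p) → index a , subst P (sym (element-index a)) p)
         (Fin.any? (P? ∘ element))

  all? : {P : A → Set ℓ} → Decidable P → Dec (∀ a → P a)
  all? {P = P} P? =
    map′ (λ f a → subst P (element-index a) (f (index a)))
         (λ f i → f (element i))
         (Fin.all? (P? ∘ element))

open Finite using (enum)

finite-Fin : ∀ n → Finite (Fin n)
finite-Fin n = record { size = n ; enum = mk↔ₛ′ id id (λ _ → refl) (λ _ → refl) }

finite-⊎ : Finite A → Finite B → Finite (A ⊎ B)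
finite-⊎ FA FB = record { enum = ↔-sym Fin.+↔⊎ ↔-∘ (enum FA ⊎-↔ enum FB) }

finite-× : Finite A → Finite B → Finite (A × B)
finite-× FA FB = record { enum = ↔-sym Fin.*↔× ↔-∘ (enum FA ×-↔ enum FB) }

private
  ΣT-step : (b : Fin (suc n) → Bool) →
            Σ (Fin (suc n)) (T ∘ b) ↔ (T (b zero) ⊎ Σ (Fin n) (T ∘ b ∘ suc))
  ΣT-step b = mk↔ₛ′
    (λ { (zero , t) → inj₁ t ; (suc i , t) → inj₂ (i , t) })
    (λ { (inj₁ t) → zero , t ; (inj₂ (i , t)) → suc i , t })
    (λ { (inj₁ t) → refl ; (inj₂ (i , t)) → refl })
    (λ { (zero , t) → refl ; (suc i , t) → refl })

  T⊎↔Fin : (b : Bool) (S : Subset n) → A ↔ Fin ∣ S ∣ → (T b ⊎ A) ↔ Fin ∣ b ∷ S ∣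
  T⊎↔Fin true  S A↔ = mk↔ₛ′
    (λ { (inj₁ _) → zero ; (inj₂ a) → suc (to a) })
    (λ { zero → inj₁ tt ; (suc i) → inj₂ (from i) })
    (λ { zero → refl ; (suc i) → cong suc (strictlyInverseˡ i) })
    (λ { (inj₁ _) → refl ; (inj₂ a) → cong inj₂ (strictlyInverseʳ a) })
    where open Inverse A↔
  T⊎↔Fin false S A↔ = mk↔ₛ′ (λ { (inj₁ ()) ; (inj₂ a) → to a }) (inj₂ ∘ from)
    strictlyInverseˡ (λ { (inj₁ ()) ; (inj₂ a) → cong inj₂ (strictlyInverseʳ a) })
    where open Inverse A↔

ΣT↔Fin : (b : Fin n → Bool) → Σ (Fin n) (T ∘ b) ↔ Fin ∣ tabulate b ∣
ΣT↔Fin {zero}  b = mk↔ₛ′ (λ ()) (λ ()) (λ ()) (λ ())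
ΣT↔Fin {suc n} b = T⊎↔Fin (b zero) (tabulate (b ∘ suc)) (ΣT↔Fin (b ∘ suc)) ↔-∘ ΣT-step b

private
  T-cong : ∀ {a b} → a ≡ b → T a ↔ T b
  T-cong refl = mk↔ₛ′ id id (λ _ → refl) (λ _ → refl)

finite-Σ : Finite A → {P : A → Set} (P? : Decidable P) →
           Finite (Σ A (λ a → True (P? a)))
finite-Σ FA P? = record
  { enum = ΣT↔Fin (isYes ∘ P? ∘ element)
           ↔-∘ Σ-↔ (enum FA) (λ {a} → T-cong (cong (isYes ∘ P?) (sym (element-index a)))) }
  where open Finite FA using (element; element-index)

private
  T-irr : ∀ {b} (x y : T b) → x ≡ y
  T-irr {true} _ _ = refl

True-≡ : {P : A → Set} {P? : Decidable P} {x y : Σ A (λ a → True (P? a))} →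
         proj₁ x ≡ proj₁ y → x ≡ y
True-≡ {x = a , s} {y = .a , t} refl = cong (a ,_) (T-irr s t)

Searchable : Set → Set₁
Searchable A = (P : A → Set) → Decidable P → Dec (∃ P)

search-Vec : Searchable A → ∀ n → Searchable (Vec A n)
search-Vec s zero    P P? = map′ ([] ,_) (λ { ([] , p) → p }) (P? [])
search-Vec s (suc n) P P? =
  map′ (λ (x , xs , p) → x ∷ xs , p) (λ { (x ∷ xs , p) → x , xs , p })
       (s _ λ x → search-Vec s n _ λ xs → P? (x ∷ xs))

search-→ : Finite A → Searchable B → (P : (A → B) → Set) →
           (∀ {f g} → f ≗ g → P f → P g) → Decidable P → Dec (∃ P)
search-→ FA s P resp P? =
  map′ (λ (v , p) → lookup v ∘ index , p)
       (λ (f , p) → tabulate (f ∘ element) , resp (λ a → sym (tab f a)) p)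
       (search-Vec s _ (λ v → P (lookup v ∘ index)) (λ v → P? (lookup v ∘ index)))
  where
  open Finite FA
  tab : ∀ f a → lookup (tabulate (f ∘ element)) (index a) ≡ f a
  tab f a = trans (lookup∘tabulate (f ∘ element) (index a)) (cong f (element-index a))

search-Fin : ∀ n → Searchable (Fin n)
search-Fin n P P? = Fin.any? P?

search-Maybe : Finite A → Searchable (Maybe A)
search-Maybe FA P P? =
  map′ [ nothing ,_ , (λ (a , p) → just a , p) ]′
       (λ { (nothing , p) → inj₁ p ; (just a , p) → inj₂ (a , p) })
       (P? nothing ⊎-dec Finite.any? FA (P? ∘ just))

IsMinimum : (ℕ → Set ℓ) → ℕ → Set ℓ
IsMinimum P m = P m × (∀ {k} → P k → m ≤ k)

minimum : (P : ℕ → Set ℓ) → (∀ t → Dec (∃ λ k → k ≤ t × P k)) →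
          ∃ P → ∃ (IsMinimum P)
minimum P P≤? (t , p) = go t (t , ≤-refl , p)
  where
  go : ∀ t → (∃ λ k → k ≤ t × P k) → ∃ (IsMinimum P)
  go zero    (k , k≤0 , p) = 0 , subst P (n≤0⇒n≡0 k≤0) p , λ _ → z≤n
  go (suc t) (k , k≤t , p) with P≤? t
  ... | yes q = go t q
  ... | no ¬q = k , p , λ {j} pj → ≤-trans k≤t (≰⇒> λ j≤t → ¬q (j , j≤t , pj))

bounded? : {P : ℕ → Set ℓ} → Decidable P → ∀ t → Dec (∃ λ k → k ≤ t × P k)
bounded? P? t = map′ (λ (k , k<t , p) → k , s≤s⁻¹ k<t , p)
                     (λ (k , k≤t , p) → k , s≤s k≤t , p)
                     (anyUpTo? P? (suc t))

record Graph : Set₁ where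
  field
    Vertex : Set
    finite : Finite Vertex
    Adj    : Rel Vertex 0ℓ
    adj?   : B.Decidable Adj
    symm   : B.Symmetric Adj
    irrefl : B.Irreflexive _≡_ Adj

open Graph using (Vertex; Adj)

infix 4 _⊑_

-- Not necessarily induced subgraphs, up to isomorphism.
_⊑_ : Graph → Graph → Set
G ⊑ H = ∃ λ (f : Vertex G → Vertex H) →
  Injective _≡_ _≡_ f × (∀ {u v} → Adj G u v → Adj H (f u) (f v))

⊑-trans : ∀ {G H K} → G ⊑ H → H ⊑ K → G ⊑ K
⊑-trans (f , f-inj , f-hom) (g , g-inj , g-hom) =
  g ∘ f , f-inj ∘ g-inj , g-hom ∘ f-hom

induced : (G : Graph) {P : Vertex G → Set} → Decidable P → Graph
induced G P? = record
  { Vertex = Σ (Vertex G) (λ v → True (P? v))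
  ; finite = finite-Σ finite P?
  ; Adj    = Adj G on proj₁
  ; adj?   = λ u v → adj? (proj₁ u) (proj₁ v)
  ; symm   = symm
  ; irrefl = λ eq → irrefl (cong proj₁ eq)
  }
  where open Graph G using (finite; adj?; symm; irrefl)

Proper : (G : Graph) {k : ℕ} → (Vertex G → Fin k) → Set
Proper G c = ∀ {u v} → Adj G u v → c u ≢ c v

Colourable : Graph → ℕ → Set
Colourable G k = ∃ λ (c : Vertex G → Fin k) → Proper G c

colourable? : ∀ G → Decidable (Colourable G)
colourable? G k = search-→ finite (search-Fin k) (Proper G)
  (λ f≗g p a eq → p a (trans (f≗g _) (trans eq (sym (f≗g _)))))
  (λ c → map′ (λ h {u} {v} → h u v) (λ h u v → h)
    (Finite.all? finite λ u → Finite.all? finite λ v →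
      adj? u v →-dec ¬? (c u Fin.≟ c v)))
  where open Graph G using (finite; adj?)

χ-minimum : ∀ G → ∃ (IsMinimum (Colourable G))
χ-minimum G = minimum (Colourable G) (bounded? (colourable? G))
  (_ , index , λ a eq → irrefl (index-injective eq) a)
  where
  open Graph G using (finite; irrefl)
  open Finite finite

χ : Graph → ℕ
χ G = proj₁ (χ-minimum G)

module _ (G : Graph) where
  open Graph G using (finite; adj?; irrefl)
  open Finite finite using (index)

  edge? : Decidable {A = Vertex G × Vertex G}
            (λ (u , v) → index u Fin.< index v × Adj G u v)
  edge? (u , v) = (index u Fin.<? index v) ×-dec adj? u v

  -- A pair u, v of adjacent vertices gives one edge, not two.
  Edge : Set
  Edge = Σ (Vertex G × Vertex G) (λ uv → True (edge? uv))

  finite-Edge : Finite Edge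
  finite-Edge = finite-Σ (finite-× finite finite) edge?

  src tgt : Edge → Vertex G
  src ((u , _) , _) = u
  tgt ((_ , v) , _) = v

  src<tgt : (e : Edge) → index (src e) Fin.< index (tgt e)
  src<tgt (uv , t) = proj₁ (toWitness {a? = edge? uv} t)

  src-adj-tgt : (e : Edge) → Adj G (src e) (tgt e)
  src-adj-tgt (uv , t) = proj₂ (toWitness {a? = edge? uv} t)

  mkEdge : ∀ {u v} → index u Fin.< index v → Adj G u v → Edge
  mkEdge {u} {v} u<v a = (u , v) , fromWitness {a? = edge? (u , v)} (u<v , a)

  module _ (p : ℕ) where

    SubVertex : Set
    SubVertex = Vertex G ⊎ (Edge × Fin p)

    path : Edge → Vec SubVertex (2 + p)
    path e = inj₁ (src e) ∷ (tabulate (λ i → inj₂ (e , i)) ∷ʳ inj₁ (tgt e))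

    Link : Rel SubVertex 0ℓ
    Link x y = ∃ λ ((e , i) : Edge × Fin (suc p)) →
      lookup (path e) (inject₁ i) ≡ x × lookup (path e) (suc i) ≡ y

    private
      finite-SubVertex : Finite SubVertex
      finite-SubVertex = finite-⊎ finite (finite-× finite-Edge (finite-Fin p))

      link? : B.Decidable Link
      link? x y = Finite.any? (finite-× finite-Edge (finite-Fin (suc p))) λ (e , i) →
        (lookup (path e) (inject₁ i) ≟′ x) ×-dec (lookup (path e) (suc i) ≟′ y)
        where open Finite finite-SubVertex renaming (_≟_ to _≟′_)

      lookup-init : ∀ {m} (f : Fin m → A) w i →
                    lookup (tabulate f ∷ʳ w) (inject₁ i) ≡ f i
      lookup-init f w zero    = refl
      lookup-init f w (suc i) = lookup-init (f ∘ suc) w i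

      lookup-either : ∀ {m} (f : Fin m → A) w i →
        (∃ λ j → toℕ j ≡ toℕ i × lookup (tabulate f ∷ʳ w) i ≡ f j)
        ⊎ lookup (tabulate f ∷ʳ w) i ≡ w
      lookup-either {m = zero}  f w zero    = inj₂ refl
      lookup-either {m = suc m} f w zero    = inj₁ (zero , refl , refl)
      lookup-either {m = suc m} f w (suc i) =
        Sum.map₁ (λ (j , eq , q) → suc j , cong suc eq , q)
                 (lookup-either (f ∘ suc) w i)

      link-irrefl : ∀ {x} → ¬ Link x x
      link-irrefl ((e , zero) , p≡ , q≡)
        with lookup-either {m = p} (λ i → inj₂ (e , i)) (inj₁ (tgt e)) zero
      ... | inj₁ (j , _ , eq) with () ← trans p≡ (trans (sym q≡) eq)
      ... | inj₂ eq =
        irrefl (Sum.inj₁-injective (trans p≡ (trans (sym q≡) eq))) (src-adj-tgt e)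
      link-irrefl ((e , suc i) , p≡ , q≡)
        with lookup-init {m = p} (λ i → inj₂ (e , i)) (inj₁ (tgt e)) i
           | lookup-either {m = p} (λ i → inj₂ (e , i)) (inj₁ (tgt e)) (suc i)
      ... | eq₁ | inj₁ (j , j≡ , eq₂)
        with refl ← trans (sym eq₁) (trans p≡ (trans (sym q≡) eq₂)) =
        1+n≢n (sym j≡)
      ... | eq₁ | inj₂ eq₂ with () ← trans (sym eq₁) (trans p≡ (trans (sym q≡) eq₂))

    subdivision : Graph
    subdivision = record
      { Vertex = SubVertex
      ; finite = finite-SubVertex
      ; Adj    = λ x y → Link x y ⊎ Link y x
      ; adj?   = λ x y → link? x y ⊎-dec link? y x
      ; symm   = Sum.swap
      ; irrefl = λ { refl → [ link-irrefl , link-irrefl ]′ }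
      }

-- In Descends parent v u, the proper ancestor is u.
Descends : (A → Maybe A) → Rel A 0ℓ
Descends parent = TransClosure (λ v u → parent v ≡ just u)

Levels : (A → Maybe A) → (A → ℕ) → Set
Levels parent level = ∀ v → level v ≡ maybe (λ u → suc (level u)) 1 (parent v)

-- level v is the number of vertices on the path from a root to v; its
-- existence is what excludes cycles of parents.
record RootedForest : Set₁ where
  field
    Node         : Set
    finite       : Finite Node
    parent       : Node → Maybe Node
    level        : Node → ℕ
    level-parent : Levels parent level

module _ (parent : A → Maybe A) (level : A → ℕ) (law : Levels parent level) where

  level-pos : ∀ v → 1 ≤ level v
  level-pos v rewrite law v with parent v
  ... | nothing = s≤s z≤n
  ... | just _  = s≤s z≤n

  level-just : ∀ {v u} → parent v ≡ just u → level v ≡ suc (level u)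
  level-just {v} eq = trans (law v) (cong (maybe (λ u → suc (level u)) 1) eq)

  descends-level : ∀ {v u} → Descends parent v u → level u < level v
  descends-level [ eq ]   = ≤-reflexive (sym (level-just eq))
  descends-level (eq ∷ d) =
    <-trans (descends-level d) (≤-reflexive (sym (level-just eq)))

  descends? : B.DecidableEquality A → B.Decidable (Descends parent)
  descends? _≟_ v u = go (level v) v ≤-refl
    where
    go : ∀ n v → level v ≤ n → Dec (Descends parent v u)
    go zero    v le = contradiction (≤-trans (level-pos v) le) λ ()
    go (suc n) v le with parent v in eq
    ... | nothing = no λ { [ q ] → absurd q ; (q ∷ _) → absurd q }
      where
      absurd : ∀ {w} → ¬ (parent v ≡ just w)
      absurd q with () ← trans (sym eq) q
    ... | just w =
      map′ [ (λ { refl → [ eq ] }) , eq ∷_ ]′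
           (λ { [ q ]   → inj₁ (same q)
              ; (q ∷ d) → inj₂ (subst (λ x → Descends parent x u) (sym (same q)) d) })
           ((w ≟ u) ⊎-dec go n w (s≤s⁻¹ (subst (_≤ suc n) (level-just eq) le)))
      where
      same : ∀ {x} → parent v ≡ just x → w ≡ x
      same q = Maybe.just-injective (trans (sym eq) q)

-- The largest level is the number of vertices on a longest root-to-leaf path.
height : RootedForest → ℕ
height Y = max 0 (List.tabulate (level ∘ Finite.element finite))
  where open RootedForest Y

level≤height : ∀ Y v → RootedForest.level Y v ≤ height Y
level≤height Y v = subst (λ x → level x ≤ height Y) (Finite.element-index finite v)
  (All.tabulate⁻ (xs≤max 0 (List.tabulate (level ∘ Finite.element finite)))
                 (Finite.index finite v))
  where open RootedForest Y

height≤ : ∀ Y {t} → (∀ v → RootedForest.level Y v ≤ t) → height Y ≤ t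
height≤ Y le = max≤v⁺ z≤n (All.tabulate⁺ (le ∘ Finite.element (RootedForest.finite Y)))

closure : RootedForest → Graph
closure Y = record
  { Vertex = Node
  ; finite = finite
  ; Adj    = λ u v → Descends parent u v ⊎ Descends parent v u
  ; adj?   = λ u v → d? u v ⊎-dec d? v u
  ; symm   = Sum.swap
  ; irrefl = λ { refl → [ d-irrefl , d-irrefl ]′ }
  }
  where
  open RootedForest Y
  d? : B.Decidable (Descends parent)
  d? = descends? parent level level-parent (Finite._≟_ finite)
  d-irrefl : ∀ {v} → ¬ Descends parent v v
  d-irrefl d = <-irrefl refl (descends-level parent level level-parent d)

ClosureHeight : Graph → ℕ → Set₁
ClosureHeight G t = ∃ λ (Y : RootedForest) → height Y ≡ t × G ⊑ closure Y

chain : ℕ → RootedForest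
chain n = record
  { Node = Fin n ; finite = finite-Fin n
  ; parent = up ; level = suc ∘ toℕ ; level-parent = law }
  where
  up : ∀ {n} → Fin n → Maybe (Fin n)
  up zero    = nothing
  up (suc i) = just (inject₁ i)
  law : ∀ {n} → Levels (up {n}) (suc ∘ toℕ)
  law zero    = refl
  law (suc i) = cong (2 +_) (sym (Fin.toℕ-inject₁ i))

height-chain : ∀ n → height (chain n) ≤ n
height-chain n = height≤ (chain n) Fin.toℕ<n

chain-descends : ∀ {n} (i j : Fin n) → toℕ j < toℕ i →
                 Descends (RootedForest.parent (chain n)) i j
chain-descends {n} i j = go i (toℕ i) refl
  where
  go : ∀ (i : Fin n) m → toℕ i ≡ m → toℕ j < m →
       Descends (RootedForest.parent (chain n)) i j
  go (suc i) (suc m) eq (s≤s j≤m) with m≤n⇒m<n∨m≡n j≤m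
  ... | inj₁ j<m = refl ∷ go (inject₁ i) m (trans (Fin.toℕ-inject₁ i) (suc-injective eq)) j<m
  ... | inj₂ j≡m = [ cong just (Fin.toℕ-injective
                     (trans (Fin.toℕ-inject₁ i) (trans (suc-injective eq) (sym j≡m)))) ]

⊑-chain : ∀ G {m} (f : Vertex G → Fin m) → Injective _≡_ _≡_ f → G ⊑ closure (chain m)
⊑-chain G {m} f inj = f , inj , hom
  where
  hom : ∀ {u v} → Adj G u v → Adj (closure (chain m)) (f u) (f v)
  hom {u} {v} a with <-cmp (toℕ (f u)) (toℕ (f v))
  ... | B.tri< lt _ _ = inj₂ (chain-descends (f v) (f u) lt)
  ... | B.tri> _ _ gt = inj₁ (chain-descends (f u) (f v) gt)
  ... | B.tri≈ _ eq _ =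
    contradiction a (Graph.irrefl G (inj (Fin.toℕ-injective eq)))

-- Existence of the minimum defining td: only forests on the vertex set of G
-- need to be searched, since Prune cuts any other forest down to one of these.
private
  module Spanning (G : Graph) where
    open Graph G using (finite; adj?)
    open Finite finite using (_≟_; all?)

    Fits : (Vertex G → Maybe (Vertex G)) → Set
    Fits parent = ∀ u v → Adj G u v → Descends parent u v ⊎ Descends parent v u

    Bounded : ℕ → Set
    Bounded t = ∃ λ (parent : Vertex G → Maybe (Vertex G)) →
      ∃ λ (level : Vertex G → Fin (suc t)) → Levels parent (toℕ ∘ level) × Fits parent

    descends-resp : {f g : A → Maybe A} → f ≗ g → ∀ {x y} → Descends f x y → Descends g x y
    descends-resp e [ q ]   = [ trans (sym (e _)) q ]
    descends-resp e (q ∷ d) = trans (sym (e _)) q ∷ descends-resp e d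

    levels-respˡ : {f g : A → Maybe A} {l : A → ℕ} → f ≗ g → Levels f l → Levels g l
    levels-respˡ {l = l} e law v =
      trans (law v) (cong (maybe (λ u → suc (l u)) 1) (e v))

    levels-respʳ : {f : A → Maybe A} {l m : A → ℕ} → l ≗ m → Levels f l → Levels f m
    levels-respʳ {f = f} {l} {m} e law v = trans (sym (e v)) (trans (law v) (lemma (f v)))
      where
      lemma : ∀ x → maybe (λ u → suc (l u)) 1 x ≡ maybe (λ u → suc (m u)) 1 x
      lemma nothing  = refl
      lemma (just u) = cong suc (e u)

    bounded-dec : ∀ t → Dec (Bounded t)
    bounded-dec t = search-→ finite (search-Maybe finite) _
      (λ e (l , law , fits) → l , levels-respˡ e law ,
        λ u v a → Sum.map (descends-resp e) (descends-resp e) (fits u v a))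
      λ parent → search-→ finite (search-Fin (suc t)) _
        (λ e (law , fits) → levels-respʳ {f = parent} (cong toℕ ∘ e) law , fits)
        λ level → both parent level
      where
      both : ∀ parent (level : Vertex G → Fin (suc t)) →
             Dec (Levels parent (toℕ ∘ level) × Fits parent)
      both parent level with all? (λ v →
        toℕ (level v) ℕ.≟ maybe (λ u → suc (toℕ (level u))) 1 (parent v))
      ... | no ¬law = no (¬law ∘ proj₁)
      ... | yes law = map′ (law ,_) proj₂
              (all? λ u → all? λ v → adj? u v →-dec (d? u v ⊎-dec d? v u))
        where
        d? : B.Decidable (Descends parent)
        d? = descends? parent (toℕ ∘ level) law _≟_

    toForest : ∀ {t} → Bounded t → ∃ λ k → k ≤ t × ClosureHeight G k
    toForest (parent , level , law , fits) =
      height Y , height≤ Y (λ v → s≤s⁻¹ (Fin.toℕ<n (level v))) ,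
      Y , refl , id , id , λ {u} {v} → fits u v
      where
      Y : RootedForest
      Y = record { finite = finite ; parent = parent ; level = toℕ ∘ level
                 ; level-parent = law }

    -- A parent function along which some rank decreases is acyclic.
    module Ranked (parent : Vertex G → Maybe (Vertex G)) (rank : Vertex G → ℕ)
                  (rank-pos : ∀ v → 1 ≤ rank v)
                  (dec : ∀ {v u} → parent v ≡ just u → rank u < rank v) where

      lv : ℕ → Vertex G → ℕ
      lv zero    v = 1
      lv (suc n) v = maybe (λ u → suc (lv n u)) 1 (parent v)

      lv-stable : ∀ n m v → rank v < n → rank v < m → lv n v ≡ lv m v
      lv-stable (suc n) (suc m) v (s≤s le) (s≤s le′) with parent v in eq
      ... | nothing = refl
      ... | just u  = cong suc (lv-stable n m u (≤-trans (dec eq) le) (≤-trans (dec eq) le′))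

      lv≤rank : ∀ n v → lv n v ≤ rank v
      lv≤rank zero    v = rank-pos v
      lv≤rank (suc n) v with parent v in eq
      ... | nothing = rank-pos v
      ... | just u  = ≤-trans (s≤s (lv≤rank n u)) (dec eq)

      lev : Vertex G → ℕ
      lev v = lv (suc (rank v)) v

      lev-law : Levels parent lev
      lev-law v with parent v in eq
      ... | nothing = refl
      ... | just u  = cong suc (lv-stable (rank v) (suc (rank u)) u (dec eq) ≤-refl)

    module Prune (Y : RootedForest) (emb : G ⊑ closure Y) where
      open RootedForest Y using (Node; level; level-parent) renaming (parent to par)

      f = proj₁ emb

      image? : ∀ y → Dec (∃ λ v → f v ≡ y)
      image? y = Finite.any? finite λ v → Finite._≟_ (RootedForest.finite Y) (f v) y

      nearest : ℕ → Node → Maybe (Vertex G)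
      nearest zero    y = nothing
      nearest (suc n) y with par y
      ... | nothing = nothing
      ... | just z with image? z
      ...   | yes (v , _) = just v
      ...   | no _        = nearest n z

      nearest-sound : ∀ n y {w} → nearest n y ≡ just w → Descends par y (f w)
      nearest-sound (suc n) y eq with par y in p≡
      nearest-sound (suc n) y eq | just z with image? z
      nearest-sound (suc n) y refl | just z | yes (v , refl) = [ p≡ ]
      ... | no _ = p≡ ∷ nearest-sound n z eq

      nearest-complete : ∀ n y {u} → level y ≤ n → Descends par y (f u) →
        ∃ λ w → nearest n y ≡ just w × (w ≡ u ⊎ Descends par (f w) (f u))
      nearest-complete zero y le d =
        contradiction (≤-trans (level-pos par level level-parent y) le) λ ()
      nearest-complete (suc n) y le [ q ] with par y | q
      ... | just z | refl with image? z
      ...   | yes (v , e) = v , refl , inj₁ (proj₁ (proj₂ emb) e)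
      ...   | no ¬i       = contradiction (_ , refl) ¬i
      nearest-complete (suc n) y le (_∷_ {y = z} q d) with level-just par level level-parent q
      ... | leq with par y | q
      ...   | just _ | refl with image? z
      ...     | yes (v , refl) = v , refl , inj₂ d
      ...     | no ¬i = nearest-complete n z (s≤s⁻¹ (subst (_≤ suc n) leq le)) d

      parent : Vertex G → Maybe (Vertex G)
      parent v = nearest (level (f v)) (f v)

      drop : ∀ {v u} → Descends par v u → level u < level v
      drop = descends-level par level level-parent

      descends : ∀ n v {u} → level (f v) ≤ n → Descends par (f v) (f u) → Descends parent v u
      descends n v le d with nearest-complete (level (f v)) (f v) ≤-refl d
      ... | w , eq , inj₁ refl = [ eq ]
      descends zero v le d | w , eq , inj₂ d′ =
        contradiction (≤-trans (level-pos par level level-parent (f v)) le) λ ()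
      descends (suc n) v le d | w , eq , inj₂ d′ =
        eq ∷ descends n w (s≤s⁻¹ (≤-trans (drop (nearest-sound (level (f v)) (f v) eq)) le)) d′

      open Ranked parent (level ∘ f)
        (λ v → level-pos par level level-parent (f v))
        (λ {v} eq → drop (nearest-sound (level (f v)) (f v) eq))

      bounded : ∀ {t} → height Y ≤ t → Bounded t
      bounded {t} h≤t = parent , (λ v → fromℕ< (lev< v)) ,
        levels-respʳ {f = parent} (λ v → sym (Fin.toℕ-fromℕ< (lev< v))) lev-law ,
        λ u v a → Sum.map (descends _ u ≤-refl) (descends _ v ≤-refl) (proj₂ (proj₂ emb) a)
        where
        lev< : ∀ v → lev v < suc t
        lev< v = s≤s (≤-trans (lv≤rank (suc (level (f v))) v) (≤-trans (level≤height Y (f v)) h≤t))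

td-minimum : ∀ G → ∃ (IsMinimum (ClosureHeight G))
td-minimum G = minimum (ClosureHeight G)
  (λ t → map′ toForest
    (λ (k , k≤t , Y , h≡ , emb) → Prune.bounded Y emb (subst (_≤ t) (sym h≡) k≤t))
    (bounded-dec t))
  (_ , chain _ , refl , ⊑-chain G index index-injective)
  where
  open Spanning G
  open Finite (Graph.finite G)

td : Graph → ℕ
td G = proj₁ (td-minimum G)

td≤height : ∀ G Y → G ⊑ closure Y → td G ≤ height Y
td≤height G Y emb = proj₂ (proj₂ (td-minimum G)) (Y , refl , emb)

td-mono : ∀ {G H} → G ⊑ H → td G ≤ td H
td-mono {G} {H} G⊑H with proj₁ (proj₂ (td-minimum H))
... | Y , h≡ , H⊑Y =
  subst (td G ≤_) h≡ (td≤height G Y (⊑-trans {G} {H} {closure Y} G⊑H H⊑Y))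

coloursIn : (G : Graph) {k : ℕ} → (Vertex G → Fin k) → Subset k → Graph
coloursIn G c I = induced G (λ v → c v ∈? I)

LowTreeDepth : ℕ → (G : Graph) {k : ℕ} → (Vertex G → Fin k) → Set
LowTreeDepth q G c = ∀ I → ∣ I ∣ ≤ q → td (coloursIn G c I) ≤ ∣ I ∣

LowTreeDepthColourable : ℕ → Graph → ℕ → Set
LowTreeDepthColourable q G k = ∃ λ (c : Vertex G → Fin k) → LowTreeDepth q G c

private
  allSubset? : {P : Subset n → Set} → Decidable P → Dec (∀ I → P I)
  allSubset? P? = map′
    (λ ¬∃ I → decidable-stable (P? I) (λ ¬p → ¬∃ (I , ¬p)))
    (λ all (I , ¬p) → ¬p (all I))
    (¬? (anySubset? (¬? ∘ P?)))

  coloursIn-resp : ∀ G {k} {c d : Vertex G → Fin k} → c ≗ d → ∀ I →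
                   coloursIn G d I ⊑ coloursIn G c I
  coloursIn-resp G {c = c} {d} e I =
    (λ (v , t) → v , fromWitness {a? = c v ∈? I}
      (subst (_∈ I) (sym (e v)) (toWitness {a? = d v ∈? I} t))) ,
    (λ eq → True-≡ {P? = λ v → d v ∈? I} (cong proj₁ eq)) , id

lowTreeDepthColourable? : ∀ q G → Decidable (LowTreeDepthColourable q G)
lowTreeDepthColourable? q G k = search-→ finite (search-Fin k) (LowTreeDepth q G)
  (λ e low I I≤q →
    ≤-trans (td-mono {coloursIn G _ I} {coloursIn G _ I} (coloursIn-resp G e I)) (low I I≤q))
  (λ c → allSubset? λ I → (∣ I ∣ ≤? q) →-dec (td (coloursIn G c I) ≤? ∣ I ∣))
  where open Graph G using (finite)

rainbow : ∀ q G → LowTreeDepth q G (Finite.index (Graph.finite G))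
rainbow q G I _ = ≤-trans (td≤height H (chain _) (⊑-chain H f f-inj))
  (≤-trans (height-chain _) (≤-reflexive (cong ∣_∣ (tabulate∘lookup I))))
  where
  open Finite (Graph.finite G) using (index; index-injective)
  H = coloursIn G index I
  member : ∀ {i} → i ∈ I → T (lookup I i)
  member i∈I = subst T (sym ([]=⇒lookup i∈I)) tt
  g : Vertex H → Σ (Fin _) (T ∘ lookup I)
  g (v , t) = index v , member (toWitness {a? = index v ∈? I} t)
  f : Vertex H → Fin ∣ tabulate (lookup I) ∣
  f = Inverse.to (ΣT↔Fin (lookup I)) ∘ g
  f-inj : Injective _≡_ _≡_ f
  f-inj {x} {y} eq = True-≡ {P? = λ v → index v ∈? I} (index-injective (cong proj₁ gx≡gy))
    where
    inv = Inverse.strictlyInverseʳ (ΣT↔Fin (lookup I))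
    gx≡gy : g x ≡ g y
    gx≡gy = trans (sym (inv (g x))) (trans (cong (Inverse.from (ΣT↔Fin (lookup I))) eq) (inv (g y)))

χ[]-minimum : ∀ q G → ∃ (IsMinimum (LowTreeDepthColourable q G))
χ[]-minimum q G = minimum (LowTreeDepthColourable q G) (bounded? (lowTreeDepthColourable? q G))
  (_ , _ , rainbow q G)

χ[_] : ℕ → Graph → ℕ
χ[ q ] G = proj₁ (χ[]-minimum q G)

{-# OPTIONS --safe #-}

-- Upper bound: extend a proper colouring of G with at least p + 2 colours so that every
-- path of the subdivision is rainbow. A set I of at most p + 1 colours then misses a vertex
-- of each path, so the components coloured in I are pieces of paths and spiders centred at
-- vertices of G whose legs repeat no colour: rooted at their centres they have height ≤ |I|.
--
-- Lower bound: colour the subdivision with N colours. It suffices to colour the graph of the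
-- monochromatic edges of G with N ^ p colours. The path of such an edge uv uses a set I of at
-- most p + 1 colours; in a forest of height ≤ |I| for I some vertex x of the path is an
-- ancestor of all the others, and u, I and the level of x determine v. When p ≥ 2, two
-- consecutive vertices of the path differ from x, so the level of x is at most |I| − 2.
-- Letting I range over the sets J ∪ {colour of u} with |J| = p orients the edges with
-- out-degree at most d = (p − 1) (N choose p), and 2 d < N ^ p; if N < p, all N colours serve
-- as J. When p = 1, x is the middle vertex and both u and v determine each other, so the
-- degrees are at most N − 1. When p = 0 there are no monochromatic edges.
module Submission where

open import Defs
open import Data.Bool.Base using (Bool; true; false; T; if_then_else_)
import Data.Bool.Properties as Bool
import Data.Empty as Empty
open import Data.Fin.Base
  using (Fin; zero; suc; toℕ; fromℕ; fromℕ<; inject₁; inject≤; punchIn; punchOut; combine; remQuot)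
import Data.Fin.Base as Fin
open import Data.Fin.Permutation.Components using (transpose; transpose-inverse)
import Data.Fin.Properties as Fin
open import Data.Fin.Relation.Unary.Top using (view; ‵fromℕ; ‵inject₁)
open import Data.Fin.Subset
  using (Subset; ⊥; ⊤; ⁅_⁆; _∪_; ∣_∣; _∈_; _∉_; _⊆_; inside; outside)
open import Data.Fin.Subset.Properties
  using (_∈?_; ∣p∣≤n; ∣⊥∣≡0; ∣⁅x⁆∣≡1; ∈⊤; x∈⁅x⁆; x∈p∪q⁺; ∪-identityˡ; ∪-idem; s⊆s; out⊆)
open import Data.List.Base using (List; []; _∷_; length; map; filter; _++_)
import Data.List.Base as List
open import Data.List.Membership.DecPropositional using () renaming (_∈?_ to _∈ˡ?_)
open import Data.List.Membership.Propositional using () renaming (_∈_ to _∈ˡ_)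
open import Data.List.Membership.Propositional.Properties
  using (∈-lookup; ∈-filter⁺; ∈-filter⁻; ∈-map⁺; ∈-tabulate⁺; ∈-++⁺ˡ; ∈-++⁺ʳ)
open import Data.List.Properties using (filter-notAll; length-map; length-++)
open import Data.List.Relation.Unary.All as All using (All; []; _∷_)
import Data.List.Relation.Unary.All.Properties as All
open import Data.List.Relation.Unary.AllPairs using ([]; _∷_)
open import Data.List.Relation.Unary.Any as Any using (here; there)
open import Data.List.Relation.Unary.Any.Properties using (lookup-index)
open import Data.List.Relation.Unary.Unique.Propositional using (Unique)
import Data.List.Relation.Unary.Unique.Propositional.Properties as Unique
open import Data.Maybe.Base using (Maybe; just; nothing)
open import Data.Maybe.Properties using (just-injective)
open import Data.Nat.Base hiding (_/_)
open import Data.Nat.ListAction using (sum)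
open import Data.Nat.Properties hiding (_≟_)
open import Data.Nat.Tactic.RingSolver using (solve-∀)
open import Data.Product.Base using (∃; _×_; _,_; proj₁; proj₂)
import Data.Product.Base as Product
open import Data.Sum.Base using (_⊎_; inj₁; inj₂; [_,_]′)
import Data.Sum.Base as Sum
import Data.Sum.Properties as Sum
open import Data.Vec.Base using ([]; _∷_; here; there; lookup; tabulate; _∷ʳ_)
open import Algebra.Properties.CommutativeSemigroup +-commutativeSemigroup using (interchange)
open import Function.Base using (_∘_; id)
open import Function.Bundles using (mk⇔; mk↔ₛ′)
open import Function.Definitions using (Injective)
open import Level using (0ℓ)
open import Relation.Binary.Construct.Closure.Transitive
  using ([_]; _∷_) renaming (_++_ to _++⁺_)
open import Relation.Binary.Core using (Rel)
import Relation.Binary.Definitions as B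
open import Relation.Binary.PropositionalEquality
  using (_≡_; _≢_; refl; sym; trans; cong; cong₂; subst; subst₂)
open import Relation.Nullary.Decidable
  using (Dec; yes; no; does; does-⇔; dec-true; dec-false; fromWitness; toWitness; T?; ¬?;
         _×-dec_; _→-dec_)
open import Relation.Nullary.Negation using (¬_; contradiction)

open Graph using (Vertex; Adj)

-- Greedy colouring

lookup-injective : {A : Set} {xs : List A} → Unique xs → Injective _≡_ _≡_ (List.lookup xs)
lookup-injective (x∉ ∷ u) {zero}  {zero}  eq = refl
lookup-injective (x∉ ∷ u) {zero}  {suc j} eq = contradiction eq (All.lookup x∉ (∈-lookup j))
lookup-injective (x∉ ∷ u) {suc i} {zero}  eq = contradiction (sym eq) (All.lookup x∉ (∈-lookup i))
lookup-injective (x∉ ∷ u) {suc i} {suc j} eq = cong suc (lookup-injective u eq)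

labels-bound : {A : Set} {d : ℕ} (R : Fin d → A → Set) → (∀ {ℓ x y} → R ℓ x → R ℓ y → x ≡ y) →
  ∀ {xs} → Unique xs → (∀ {x} → x ∈ˡ xs → ∃ λ ℓ → R ℓ x) → length xs ≤ d
labels-bound R fun {xs} uniq lab = Fin.injective⇒≤ {f = label} λ {i} {j} eq →
  lookup-injective uniq (fun (proj₂ (lab (∈-lookup i)))
    (subst (λ ℓ → R ℓ _) (sym eq) (proj₂ (lab (∈-lookup j)))))
  where
  label : Fin (length xs) → Fin _
  label i = proj₁ (lab (∈-lookup i))

avoid : ∀ {k} (xs : List (Fin k)) → length xs < k → ∃ λ i → ¬ (i ∈ˡ xs)
avoid {k} xs lt = Fin.¬∀⟶∃¬ k (_∈ˡ xs) (λ i → _∈ˡ?_ Fin._≟_ i xs) λ all →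
  <⇒≱ lt (Fin.injective⇒≤ {f = λ i → Any.index (all i)} (inj all))
  where
  at : ∀ {i : Fin k} {xs} (m : i ∈ˡ xs) → List.lookup xs (Any.index m) ≡ i
  at (here refl) = refl
  at (there m)   = at m
  inj : (all : ∀ i → i ∈ˡ xs) → Injective _≡_ _≡_ (λ i → Any.index (all i))
  inj all {i} {j} eq = trans (sym (at (all i))) (trans (cong (List.lookup xs) eq) (at (all j)))

∑ : {A : Set} → List A → (A → ℕ) → ℕ
∑ xs f = sum (map f xs)

module _ {A : Set} where

  ∑-mono : ∀ (xs : List A) {f g : A → ℕ} → (∀ x → f x ≤ g x) → ∑ xs f ≤ ∑ xs g
  ∑-mono []       f≤g = z≤n
  ∑-mono (x ∷ xs) f≤g = +-mono-≤ (f≤g x) (∑-mono xs f≤g)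

  ∑-+ : ∀ (xs : List A) (f g : A → ℕ) → ∑ xs (λ x → f x + g x) ≡ ∑ xs f + ∑ xs g
  ∑-+ []       f g = refl
  ∑-+ (x ∷ xs) f g = trans (cong (f x + g x +_) (∑-+ xs f g)) (interchange (f x) (g x) _ _)

  ∑-≤ : ∀ (xs : List A) {f : A → ℕ} {b} → (∀ x → f x ≤ b) → ∑ xs f ≤ length xs * b
  ∑-≤ []       f≤b = z≤n
  ∑-≤ (x ∷ xs) f≤b = +-mono-≤ (f≤b x) (∑-≤ xs f≤b)

  ∑-zero : ∀ (xs : List A) → ∑ xs (λ _ → 0) ≡ 0
  ∑-zero []       = refl
  ∑-zero (x ∷ xs) = ∑-zero xs

  ∑-swap : ∀ (xs ys : List A) (f : A → A → ℕ) →
           ∑ xs (λ x → ∑ ys (f x)) ≡ ∑ ys (λ y → ∑ xs (λ x → f x y))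
  ∑-swap []       ys f = sym (∑-zero ys)
  ∑-swap (x ∷ xs) ys f = trans (cong (∑ ys (f x) +_) (∑-swap xs ys f))
                               (sym (∑-+ ys (f x) (λ y → ∑ xs (λ x → f x y))))

  below-average : ∀ x (xs : List A) {f : A → ℕ} {b} → ∑ (x ∷ xs) f ≤ length (x ∷ xs) * b →
                  ∃ λ y → y ∈ˡ x ∷ xs × f y ≤ b
  below-average x xs {f} {b} le with f x ≤? b
  below-average x xs {f} {b} le | yes fx≤b = x , here refl , fx≤b
  below-average x [] {f} {b} le | no fx≰b =
    contradiction (≤-trans (m≤m+n _ _) (≤-trans le (≤-reflexive (+-identityʳ b)))) fx≰b
  -- Since `f x` exceeds `b`, taking it away leaves a list whose average is still at most `b`.
  below-average x (y ∷ ys) {f} {b} le | no fx≰b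
    with z , z∈ , fz≤b ← below-average y ys (+-cancelˡ-≤ b _ _
           (≤-trans (+-monoˡ-≤ _ (<⇒≤ (≰⇒> fx≰b))) le)) = z , there z∈ , fz≤b

indicator : Bool → ℕ
indicator b = if b then 1 else 0

∑-indicator : {A : Set} {P : A → Set} (P? : ∀ x → Dec (P x)) (xs : List A) →
              ∑ xs (indicator ∘ does ∘ P?) ≡ length (filter P? xs)
∑-indicator P? []       = refl
∑-indicator P? (x ∷ xs) with does (P? x)
... | true  = cong suc (∑-indicator P? xs)
... | false = ∑-indicator P? xs

module _ {V : Set} (finite : Finite V) (E : Rel V 0ℓ) (E? : B.Decidable E)
         (E-sym : B.Symmetric E) (E-irrefl : B.Irreflexive _≡_ E) where
  open Finite finite using (_≟_; element; index; element-index; index-element)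

  Colouring : ℕ → Set
  Colouring k = ∃ λ (c : V → Fin k) → ∀ {u v} → E u v → c u ≢ c v

  -- Delete a vertex `u` with at most `d` neighbours in the list, colour the rest, and give `u` one
  -- of the `suc d` colours that its neighbours miss.
  degenerate⇒colouring : ∀ {d} → (∀ v vs → Unique (v ∷ vs) →
    ∃ λ u → u ∈ˡ v ∷ vs × length (filter (E? u) (v ∷ vs)) ≤ d) → Colouring (suc d)
  degenerate⇒colouring {d} degenerate =
    let c , proper = go _ (List.tabulate element) ≤-refl
                        (Unique.tabulate⁺ λ {i} {j} eq →
                          trans (sym (index-element i)) (trans (cong index eq) (index-element j)))
    in c , λ {u} {v} → proper (everything u) (everything v)
    where
    everything : ∀ v → v ∈ˡ List.tabulate element
    everything v = subst (_∈ˡ List.tabulate element) (element-index v) (∈-tabulate⁺ (index v))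

    others : ∀ u w → Dec (w ≢ u)
    others u w = ¬? (w ≟ u)

    go : ∀ n vs → length vs ≤ n → Unique vs → ∃ λ (c : V → Fin (suc d)) →
         ∀ {u v} → u ∈ˡ vs → v ∈ˡ vs → E u v → c u ≢ c v
    go _       []       _  _    = (λ _ → zero) , λ ()
    go (suc n) (v ∷ vs) le uniq
      with u , u∈ , few ← degenerate v vs uniq
      with c , proper ← go n (filter (others u) (v ∷ vs))
             (s≤s⁻¹ (≤-trans (filter-notAll (others u) (v ∷ vs)
                               (Any.map (λ { refl ¬p → ¬p refl }) u∈)) le))
             (Unique.filter⁺ (others u) uniq)
      with γ , γ∉ ← avoid (map c (filter (E? u) (v ∷ vs)))
             (s≤s (≤-trans (≤-reflexive (length-map c (filter (E? u) (v ∷ vs)))) few)) = c′ , proper′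
      where
      c′ : V → Fin (suc d)
      c′ w with w ≟ u
      ... | yes _ = γ
      ... | no _  = c w
      fresh : ∀ {w} → w ∈ˡ v ∷ vs → E u w → γ ≢ c w
      fresh w∈ e refl = γ∉ (∈-map⁺ c (∈-filter⁺ (E? u) w∈ e))
      proper′ : ∀ {x y} → x ∈ˡ v ∷ vs → y ∈ˡ v ∷ vs → E x y → c′ x ≢ c′ y
      proper′ {x} {y} x∈ y∈ e with x ≟ u | y ≟ u
      ... | yes refl | yes y≡u = contradiction e (E-irrefl (sym y≡u))
      ... | yes refl | no _    = fresh y∈ e
      ... | no _     | yes refl = fresh x∈ (E-sym e) ∘ sym
      ... | no x≢u   | no y≢u  = proper (∈-filter⁺ (others u) x∈ x≢u) (∈-filter⁺ (others u) y∈ y≢u) e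

  colouring-mono : ∀ {k l} → k ≤ l → Colouring k → Colouring l
  colouring-mono k≤l (c , proper) =
    (λ v → inject≤ (c v) k≤l) , λ e eq → proper e (Fin.inject≤-injective k≤l k≤l _ _ eq)

  module _ {d} (R : V → Fin d → V → Set)
           (functional : ∀ {u ℓ v w} → R u ℓ v → R u ℓ w → v ≡ w) where

    -- A label determines the other end of an edge at `u`, so every vertex has degree at most `d`
    -- and the head of the list can always be deleted.
    labelled⇒colouring : (∀ {u v} → E u v → ∃ λ ℓ → R u ℓ v) → Colouring (suc d)
    labelled⇒colouring label = degenerate⇒colouring λ v vs uniq → v , here refl ,
      labels-bound (R v) functional (Unique.filter⁺ (E? v) uniq)
        (label ∘ proj₂ ∘ ∈-filter⁻ (E? v) {xs = v ∷ vs})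

    -- The labels orient E with out-degree at most d, so every induced subgraph
    -- has average degree at most 2d.
    orientation⇒colouring :
      (∀ {u v} → E u v → (∃ λ ℓ → R u ℓ v) ⊎ (∃ λ ℓ → R v ℓ u)) → Colouring (suc (d + d))
    orientation⇒colouring choose = degenerate⇒colouring λ v vs uniq →
      let u , u∈ , le = below-average v vs (total (v ∷ vs) uniq)
      in u , u∈ , ≤-trans (≤-reflexive (sym (∑-indicator (E? u) (v ∷ vs)))) le
      where
      open ≤-Reasoning
      -- Every ordered pair of adjacent vertices counts once, in `out` or in `into`; the choices
      -- made for (u, v) and for (v, u) need not agree.
      out into : ∀ {u v} → Dec (E u v) → Bool
      out (no _)   = false
      out (yes e)  = [ (λ _ → true) , (λ _ → false) ]′ (choose e)
      into (no _)  = false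
      into (yes e) = [ (λ _ → false) , (λ _ → true) ]′ (choose e)
      split : ∀ {u v} (e? : Dec (E u v)) →
              indicator (does e?) ≤ indicator (out e?) + indicator (into e?)
      split (no _) = z≤n
      split (yes e) with choose e
      ... | inj₁ _ = ≤-refl
      ... | inj₂ _ = ≤-refl
      out-label : ∀ {u v} (e? : Dec (E u v)) → T (out e?) → ∃ λ ℓ → R u ℓ v
      out-label (yes e) t with inj₁ r ← choose e = r
      into-label : ∀ {u v} (e? : Dec (E u v)) → T (into e?) → ∃ λ ℓ → R v ℓ u
      into-label (yes e) t with inj₂ r ← choose e = r
      bound : ∀ u (b : V → Bool) → (∀ v → T (b v) → ∃ λ ℓ → R u ℓ v) →
              ∀ {vs} → Unique vs → ∑ vs (indicator ∘ b) ≤ d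
      bound u b lab {vs} uniq = ≤-trans (≤-reflexive (∑-indicator (T? ∘ b) vs))
        (labels-bound (R u) functional (Unique.filter⁺ (T? ∘ b) uniq)
          λ {v} v∈ → lab v (proj₂ (∈-filter⁻ (T? ∘ b) {xs = vs} v∈)))
      total : ∀ vs → Unique vs →
              ∑ vs (λ u → ∑ vs (λ v → indicator (does (E? u v)))) ≤ length vs * (d + d)
      total vs uniq = begin
        ∑ vs (λ u → ∑ vs (λ v → indicator (does (E? u v))))
          ≤⟨ ∑-mono vs (λ u → ≤-trans (∑-mono vs (λ v → split (E? u v)))
                                      (≤-reflexive (∑-+ vs _ _))) ⟩
        ∑ vs (λ u → ∑ vs (outs u) + ∑ vs (intos u))
          ≡⟨ ∑-+ vs _ _ ⟩
        ∑ vs (λ u → ∑ vs (outs u)) + ∑ vs (λ u → ∑ vs (intos u))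
          -- Swapping the sums groups the pairs in `into` by the vertex that carries the label.
          ≡⟨ cong (∑ vs (λ u → ∑ vs (outs u)) +_) (∑-swap vs vs intos) ⟩
        ∑ vs (λ u → ∑ vs (outs u)) + ∑ vs (λ v → ∑ vs (λ u → intos u v))
          ≤⟨ +-mono-≤
               (∑-≤ vs λ u → bound u (λ v → out (E? u v)) (λ v → out-label (E? u v)) uniq)
               (∑-≤ vs λ v → bound v (λ u → into (E? u v)) (λ u → into-label (E? u v)) uniq) ⟩
        length vs * d + length vs * d
          ≡⟨ *-distribˡ-+ (length vs) d d ⟨
        length vs * (d + d) ∎
        where
        outs intos : V → V → ℕ
        outs u v  = indicator (out (E? u v))
        intos u v = indicator (into (E? u v))

-- Families of small subsets

∣⁅x⁆∪p∣≤1+∣p∣ : ∀ {n} (x : Fin n) (p : Subset n) → ∣ ⁅ x ⁆ ∪ p ∣ ≤ suc ∣ p ∣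
∣⁅x⁆∪p∣≤1+∣p∣ zero    (inside  ∷ p) rewrite ∪-identityˡ p = n≤1+n _
∣⁅x⁆∪p∣≤1+∣p∣ zero    (outside ∷ p) rewrite ∪-identityˡ p = ≤-refl
∣⁅x⁆∪p∣≤1+∣p∣ (suc x) (inside  ∷ p) = s≤s (∣⁅x⁆∪p∣≤1+∣p∣ x p)
∣⁅x⁆∪p∣≤1+∣p∣ (suc x) (outside ∷ p) = ∣⁅x⁆∪p∣≤1+∣p∣ x p

image : ∀ {m n} → (Fin m → Fin n) → Subset n
image {zero}  g = ⊥
image {suc m} g = ⁅ g zero ⁆ ∪ image (g ∘ suc)

∣image∣≤ : ∀ {m n} (g : Fin m → Fin n) → ∣ image g ∣ ≤ m
∣image∣≤ {zero}  {n} g = ≤-reflexive (∣⊥∣≡0 n)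
∣image∣≤ {suc m} g = ≤-trans (∣⁅x⁆∪p∣≤1+∣p∣ (g zero) _) (s≤s (∣image∣≤ (g ∘ suc)))

∈-image : ∀ {m n} (g : Fin m → Fin n) i → g i ∈ image g
∈-image g zero    = x∈p∪q⁺ (inj₁ (x∈⁅x⁆ (g zero)))
∈-image g (suc i) = x∈p∪q⁺ {p = ⁅ g zero ⁆} (inj₂ (∈-image (g ∘ suc) i))

subsets : ∀ n → ℕ → List (Subset n)
subsets n       zero    = ⊥ ∷ []
subsets zero    (suc k) = []
subsets (suc n) (suc k) = map (inside ∷_) (subsets n k) ++ map (outside ∷_) (subsets n (suc k))

subsets-size : ∀ n k → All (λ p → ∣ p ∣ ≤ k) (subsets n k)
subsets-size n       zero    = ≤-reflexive (∣⊥∣≡0 n) ∷ []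
subsets-size zero    (suc k) = []
subsets-size (suc n) (suc k) = All.++⁺ (All.map⁺ (All.map s≤s (subsets-size n k)))
                                       (All.map⁺ (subsets-size n (suc k)))

∣p∣≤0⇒⊆⊥ : ∀ {n} (p : Subset n) → ∣ p ∣ ≤ 0 → p ⊆ ⊥
∣p∣≤0⇒⊆⊥ []            _  = λ ()
∣p∣≤0⇒⊆⊥ (outside ∷ p) le = s⊆s (∣p∣≤0⇒⊆⊥ p le)

subsets-cover : ∀ {n k} → k ≤ n → (p : Subset n) → ∣ p ∣ ≤ k →
                ∃ λ q → q ∈ˡ subsets n k × p ⊆ q
subsets-cover {n} {zero} _ p le = ⊥ , here refl , ∣p∣≤0⇒⊆⊥ p le
subsets-cover (s≤s k≤n) (inside ∷ p) (s≤s le)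
  with q , q∈ , p⊆q ← subsets-cover k≤n p le =
  inside ∷ q , ∈-++⁺ˡ (∈-map⁺ _ q∈) , s⊆s p⊆q
subsets-cover {suc n} {suc k} (s≤s k≤n) (outside ∷ p) le with m≤n⇒m<n∨m≡n k≤n
... | inj₁ k<n with q , q∈ , p⊆q ← subsets-cover k<n p le =
  outside ∷ q , ∈-++⁺ʳ (map (inside ∷_) (subsets n k)) (∈-map⁺ _ q∈) , s⊆s p⊆q
-- Here k = n, so a set of n + 1 elements has to contain the first one as well.
... | inj₂ refl with q , q∈ , p⊆q ← subsets-cover k≤n p (∣p∣≤n p) =
  inside ∷ q , ∈-++⁺ˡ (∈-map⁺ _ q∈) , out⊆ p⊆q

length-subsets-suc : ∀ n k → length (subsets (suc n) (suc k)) ≡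
                     length (subsets n k) + length (subsets n (suc k))
length-subsets-suc n k = trans (length-++ (map (inside ∷_) (subsets n k)))
  (cong₂ _+_ (length-map (inside ∷_) (subsets n k)) (length-map (outside ∷_) (subsets n (suc k))))

-- These are the first two terms of the binomial expansion of the right side.
bernoulli : ∀ n k → n ^ suc k + suc k * n ^ k ≤ suc n ^ suc k
bernoulli n zero    = ≤-reflexive (lemma n)
  where
  lemma : ∀ n → n * 1 + 1 * 1 ≡ suc n * 1
  lemma = solve-∀
bernoulli n (suc k) = begin
  n * n ^ suc k + suc (suc k) * n ^ suc k ≡⟨ lemma₁ (n ^ suc k) n k ⟩
  n ^ suc k + n * n ^ suc k + suc k * (n * n ^ k) ≤⟨ m≤m+n _ (suc k * n ^ k) ⟩
  n ^ suc k + n * n ^ suc k + suc k * (n * n ^ k) + suc k * n ^ k ≡⟨ lemma₂ (n ^ suc k) n k (n ^ k) ⟩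
  suc n * (n ^ suc k + suc k * n ^ k) ≤⟨ *-monoʳ-≤ (suc n) (bernoulli n k) ⟩
  suc n * suc n ^ suc k ∎
  where
  open ≤-Reasoning
  lemma₁ : ∀ x n k → n * x + suc (suc k) * x ≡ x + n * x + suc k * x
  lemma₁ = solve-∀
  lemma₂ : ∀ x n k y → x + n * x + suc k * (n * y) + suc k * y ≡ suc n * (x + suc k * y)
  lemma₂ = solve-∀

factorial-split : ∀ k f x y → suc k * f * (x + y) ≡ suc k * (f * x) + suc k * f * y
factorial-split = solve-∀

-- The left side is the falling factorial n (n - 1) ⋯ (n - k + 1). Pascal's rule for the lengths
-- reduces the step to `bernoulli`.
subsets-count : ∀ n k → k ! * length (subsets n k) ≤ n ^ k
subsets-count n       zero    = ≤-refl
subsets-count zero    (suc k) = ≤-reflexive (*-zeroʳ (suc k !))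
subsets-count (suc n) (suc k) = begin
  suc k ! * length (subsets (suc n) (suc k))
    ≡⟨ cong (suc k ! *_) (length-subsets-suc n k) ⟩
  suc k ! * (length (subsets n k) + length (subsets n (suc k)))
    ≡⟨ factorial-split k (k !) (length (subsets n k)) (length (subsets n (suc k))) ⟩
  suc k * (k ! * length (subsets n k)) + suc k ! * length (subsets n (suc k))
    ≤⟨ +-mono-≤ (*-monoʳ-≤ (suc k) (subsets-count n k)) (subsets-count n (suc k)) ⟩
  suc k * n ^ k + n ^ suc k ≡⟨ +-comm (suc k * n ^ k) _ ⟩
  n ^ suc k + suc k * n ^ k ≤⟨ bernoulli n k ⟩
  suc n ^ suc k ∎
  where open ≤-Reasoning

-- Strictness pays for the one colour beyond twice the out-degree. It starts from a set with one
-- element, which has no subset of `2 + k` elements.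
subsets-count-< : ∀ n k → (2 + k) ! * length (subsets (suc n) (2 + k)) < suc n ^ (2 + k)
subsets-count-< zero    k = begin-strict
  (2 + k) ! * length (subsets 1 (2 + k)) ≡⟨ *-zeroʳ ((2 + k) !) ⟩
  0                                      <⟨ m^n>0 1 (2 + k) ⟩
  1 ^ (2 + k)                            ∎
  where open ≤-Reasoning
subsets-count-< (suc n) k = begin-strict
  (2 + k) ! * length (subsets (2 + n) (2 + k))
    ≡⟨ cong ((2 + k) ! *_) (length-subsets-suc (suc n) (suc k)) ⟩
  (2 + k) ! * (length (subsets (suc n) (suc k)) + length (subsets (suc n) (2 + k)))
    ≡⟨ factorial-split (suc k) (suc k !) (length (subsets (suc n) (suc k))) _ ⟩
  suc (suc k) * (suc k ! * length (subsets (suc n) (suc k))) + (2 + k) ! * length (subsets (suc n) (2 + k))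
    <⟨ +-mono-≤-< (*-monoʳ-≤ (2 + k) (subsets-count (suc n) (suc k))) (subsets-count-< n k) ⟩
  (2 + k) * suc n ^ suc k + suc n ^ (2 + k) ≡⟨ +-comm ((2 + k) * suc n ^ suc k) _ ⟩
  suc n ^ (2 + k) + (2 + k) * suc n ^ suc k ≤⟨ bernoulli (suc n) (suc k) ⟩
  (2 + n) ^ (2 + k) ∎
  where open ≤-Reasoning

-- With p = 2 + k, the factorial p! of the counting bound absorbs the factor 2 (p - 1) of twice the
-- out-degree.
2*suc≤factorial : ∀ k → 2 * suc k ≤ (2 + k) !
2*suc≤factorial k = *-mono-≤ {2} {2 + k} (s≤s (s≤s z≤n)) (m≤m*n (suc k) (k !))
  where instance _ = k !≢0

-- A pair of a set and a level from 1 to depth labels an arc of the orientation; the colour a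
-- is that of the endpoints.
record Cover (n k : ℕ) : Set where
  field
    size depth : ℕ
    set        : Fin size → Subset n
    small      : ∀ i a → ∣ ⁅ a ⁆ ∪ set i ∣ ≤ suc k
    shallow    : ∀ i a → ∣ ⁅ a ⁆ ∪ set i ∣ ≤ 2 + depth
    covers     : (g : Fin k → Fin n) → ∃ λ i → ∀ j → g j ∈ set i
    cheap      : 2 * (size * depth) < n ^ k

cover : ∀ n k → Cover (suc n) (2 + k)
cover n k with 2 + k ≤? suc n
... | yes k≤n = record
  { size    = length (subsets (suc n) (2 + k))
  ; depth   = suc k
  ; set     = List.lookup (subsets (suc n) (2 + k))
  ; small   = bound
  ; shallow = bound
  ; covers  = λ g →
      let q , q∈ , g⊆q = subsets-cover k≤n (image g) (∣image∣≤ g)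
      in Any.index q∈ , λ j → subst (g j ∈_) (lookup-index q∈) (g⊆q (∈-image g j))
  ; cheap   = begin-strict
      2 * (size * suc k) ≡⟨ lemma size k ⟩
      2 * suc k * size   ≤⟨ *-monoˡ-≤ size (2*suc≤factorial k) ⟩
      (2 + k) ! * size   <⟨ subsets-count-< n k ⟩
      suc n ^ (2 + k)    ∎
  }
  where
  open ≤-Reasoning
  size : ℕ
  size = length (subsets (suc n) (2 + k))
  lemma : ∀ s k → 2 * (s * suc k) ≡ 2 * suc k * s
  lemma = solve-∀
  bound : ∀ i a → ∣ ⁅ a ⁆ ∪ List.lookup (subsets (suc n) (2 + k)) i ∣ ≤ 3 + k
  bound i a = ≤-trans (∣⁅x⁆∪p∣≤1+∣p∣ a _) (s≤s (All.lookup (subsets-size (suc n) (2 + k)) (∈-lookup i)))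
... | no k≰n = record
  { size    = 1
  -- With one colour the truncated difference is 0 and there are no labels at all, as no level lies
  -- between 1 and 0.
  ; depth   = suc n ∸ 2
  ; set     = λ _ → ⊤
  ; small   = λ i a → ≤-trans (∣p∣≤n (⁅ a ⁆ ∪ ⊤)) (≤-trans (<⇒≤ (≰⇒> k≰n)) (n≤1+n (2 + k)))
  ; shallow = λ i a → ≤-trans (∣p∣≤n (⁅ a ⁆ ∪ ⊤)) (m≤n+m∸n (suc n) 2)
  ; covers  = λ g → zero , λ j → ∈⊤
  ; cheap   = few n
  }
  where
  open ≤-Reasoning
  few : ∀ n → 2 * (1 * (suc n ∸ 2)) < suc n ^ (2 + k)
  few zero    = m^n>0 1 (2 + k)
  few (suc n) = begin-strict
    2 * (1 * n)             ≡⟨ cong (2 *_) (*-identityˡ n) ⟩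
    2 * n                   <⟨ *-monoʳ-< 2 (s≤s (n≤1+n n)) ⟩
    2 * (2 + n)             ≤⟨ *-monoˡ-≤ (2 + n) {2} {2 + n} (s≤s (s≤s z≤n)) ⟩
    (2 + n) * (2 + n)       ≤⟨ *-monoʳ-≤ (2 + n) (m≤m*n (2 + n) ((2 + n) ^ k)) ⟩
    (2 + n) ^ (2 + k)       ∎
    where instance _ = m^n≢0 (2 + n) k

-- Rainbow paths and spiders

module _ (G : Graph) {p : ℕ} where

  private
    lookup-last : ∀ {A : Set} {m} (f : Fin m → A) {x} → lookup (tabulate f ∷ʳ x) (fromℕ m) ≡ x
    lookup-last {m = zero}  f = refl
    lookup-last {m = suc m} f = lookup-last (f ∘ suc)

    lookup-init : ∀ {A : Set} {m} (f : Fin m → A) {x} i → lookup (tabulate f ∷ʳ x) (inject₁ i) ≡ f i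
    lookup-init f zero    = refl
    lookup-init f (suc i) = lookup-init (f ∘ suc) i

  path-inner : ∀ e j → lookup (path G p e) (suc (inject₁ j)) ≡ inj₂ (e , j)
  path-inner e = lookup-init λ j → inj₂ (e , j)

  path-end : ∀ e → lookup (path G p e) (suc (fromℕ p)) ≡ inj₁ (tgt G e)
  path-end e = lookup-last λ j → inj₂ (e , j)

  -- A view of the path: `lookup` into a list extended at its end does not reduce at a variable
  -- index.
  data Position (e : Edge G) : Fin (2 + p) → SubVertex G p → Set where
    start : Position e zero (inj₁ (src G e))
    inner : ∀ j → Position e (suc (inject₁ j)) (inj₂ (e , j))
    end   : Position e (suc (fromℕ p)) (inj₁ (tgt G e))

  position : ∀ e i → Position e i (lookup (path G p e) i)
  position e zero    = start
  position e (suc i) with view i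
  ... | ‵fromℕ     = subst (Position e _) (sym (path-end e)) end
  ... | ‵inject₁ j = subst (Position e _) (sym (path-inner e j)) (inner j)

  -- With a colouring for `g` this makes the path rainbow; with `id` it shows that its vertices are
  -- distinct.
  path-injective : ∀ {A : Set} (g : SubVertex G p → A) e →
    g (inj₁ (src G e)) ≢ g (inj₁ (tgt G e)) →
    (∀ {i j} → g (inj₂ (e , i)) ≡ g (inj₂ (e , j)) → i ≡ j) →
    (∀ i → g (inj₂ (e , i)) ≢ g (inj₁ (src G e))) →
    (∀ i → g (inj₂ (e , i)) ≢ g (inj₁ (tgt G e))) →
    Injective _≡_ _≡_ (g ∘ lookup (path G p e))
  path-injective g e s≢t inn ≢s ≢t {i} {j} eq = go (position e i) (position e j) eq
    where
    go : ∀ {i j x y} → Position e i x → Position e j y → g x ≡ g y → i ≡ j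
    go start     start     _  = refl
    go start     (inner j) eq = contradiction (sym eq) (≢s j)
    go start     end       eq = contradiction eq s≢t
    go (inner i) start     eq = contradiction eq (≢s i)
    go (inner i) (inner j) eq = cong (suc ∘ inject₁) (inn eq)
    go (inner i) end       eq = contradiction eq (≢t i)
    go end       start     eq = contradiction (sym eq) s≢t
    go end       (inner j) eq = contradiction (sym eq) (≢t j)
    go end       end       _  = refl

rank : ∀ {n} {I : Subset n} {x} → x ∈ I → Fin ∣ I ∣
rank {I = inside  ∷ I} here      = zero
rank {I = inside  ∷ I} (there q) = suc (rank q)
rank {I = outside ∷ I} (there q) = rank q

rank-injective : ∀ {n} {I : Subset n} {x y} (q : x ∈ I) (r : y ∈ I) → rank q ≡ rank r → x ≡ y
rank-injective {I = inside  ∷ I} here      here      eq = refl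
rank-injective {I = inside  ∷ I} (there q) (there r) eq =
  cong suc (rank-injective q r (Fin.suc-injective eq))
rank-injective {I = outside ∷ I} (there q) (there r) eq = cong suc (rank-injective q r eq)

rank-irrelevant : ∀ {n} {I : Subset n} {x} (q r : x ∈ I) → rank q ≡ rank r
rank-irrelevant {I = inside  ∷ I} here      here      = refl
rank-irrelevant {I = inside  ∷ I} (there q) (there r) = cong suc (rank-irrelevant q r)
rank-irrelevant {I = outside ∷ I} (there q) (there r) = rank-irrelevant q r

-- A transposition is enough: the closure of a chain is complete, so it only matters which colour
-- comes first.
toTop : ∀ {n} → Fin n → Fin n → Fin n
toTop {suc n} i = transpose i zero

toTop-injective : ∀ {n} (i : Fin n) → Injective _≡_ _≡_ (toTop i)
toTop-injective {suc n} i eq = trans (sym (transpose-inverse zero i))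
  (trans (cong (transpose zero i) eq) (transpose-inverse zero i))

toTop-self : ∀ {n} (i : Fin n) → toℕ (toTop i i) ≡ 0
toTop-self {suc n} i rewrite dec-true (i Fin.≟ i) refl = refl

-- A chain of t nodes for each s, where the first node of the chain of s is
-- replaced by that of the chain of hub s.
module Comb {S : Set} (finite : Finite S) (hub : S → S) (t : ℕ) where

  Node : Set
  Node = S × Fin t

  at : S → Fin t → Node
  at s zero    = hub s , zero
  at s (suc k) = s , suc k

  parent : Node → Maybe Node
  parent (s , zero)  = nothing
  parent (s , suc k) = just (at s (inject₁ k))

  toℕ-at : ∀ s k → toℕ (proj₂ (at s k)) ≡ toℕ k
  toℕ-at s zero    = refl
  toℕ-at s (suc k) = refl

  comb : RootedForest
  comb = record
    { Node = Node ; finite = finite-× finite (finite-Fin t)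
    ; parent = parent ; level = suc ∘ toℕ ∘ proj₂ ; level-parent = law }
    where
    law : Levels parent (suc ∘ toℕ ∘ proj₂)
    law (s , zero)  = refl
    law (s , suc k) = cong (2 +_) (sym (trans (toℕ-at s (inject₁ k)) (Fin.toℕ-inject₁ k)))

  height-comb : height comb ≤ t
  height-comb = height≤ comb (Fin.toℕ<n ∘ proj₂)

  at-hub : ∀ {s s′} k → hub s ≡ hub s′ → toℕ k ≡ 0 → at s k ≡ at s′ k
  at-hub zero eq _ = cong (_, zero) eq

  at-fixed : ∀ {s} k → hub s ≡ s → at s k ≡ (s , k)
  at-fixed zero    eq = cong (_, zero) eq
  at-fixed (suc k) _  = refl

  at-below : ∀ {s} k → toℕ k ≢ 0 → at s k ≡ (s , k)
  at-below zero    k≢0 = contradiction refl k≢0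
  at-below (suc k) _   = refl

  at-descends : ∀ s {i j} → toℕ i < toℕ j → Descends parent (at s j) (at s i)
  at-descends s {i} {j} = go j (toℕ j) refl
    where
    go : ∀ (j : Fin t) m → toℕ j ≡ m → toℕ i < m → Descends parent (at s j) (at s i)
    go (suc j) (suc m) eq (s≤s i≤m) with m≤n⇒m<n∨m≡n i≤m
    ... | inj₁ i<m = refl ∷ go (inject₁ j) m (trans (Fin.toℕ-inject₁ j) (suc-injective eq)) i<m
    ... | inj₂ i≡m = [ cong (just ∘ at s) (Fin.toℕ-injective
                       (trans (Fin.toℕ-inject₁ j) (trans (suc-injective eq) (sym i≡m)))) ]

  at-adj : ∀ s {i j} → i ≢ j → Adj (closure comb) (at s i) (at s j)
  at-adj s {i} {j} i≢j with <-cmp (toℕ i) (toℕ j)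
  ... | B.tri< lt _ _ = inj₂ (at-descends s lt)
  ... | B.tri≈ _ eq _ = contradiction (Fin.toℕ-injective eq) i≢j
  ... | B.tri> _ _ gt = inj₁ (at-descends s gt)

module RainbowPaths (G : Graph) (p : ℕ) {k : ℕ} (c : SubVertex G p → Fin k)
  (rainbow-path : ∀ e → Injective _≡_ _≡_ (c ∘ lookup (path G p e)))
  (I : Subset k) (I≤ : ∣ I ∣ ≤ suc p) where

  H : Graph
  H = coloursIn (subdivision G p) c I

  w : Edge G → Fin (2 + p) → SubVertex G p
  w e = lookup (path G p e)

  not-full : ∀ e → ¬ (∀ i → c (w e i) ∈ I)
  not-full e full = <⇒≱ (s≤s I≤) (Fin.injective⇒≤ {f = λ i → rank (full i)} λ {i} {j} eq →
    rainbow-path e (rank-injective (full i) (full j) eq))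

  Run : Edge G → Fin (2 + p) → Set
  Run e i = ∀ j → j Fin.≤ i → c (w e j) ∈ I

  run? : ∀ e i → Dec (Run e i)
  run? e i = Fin.all? λ j → (j Fin.≤? i) →-dec (c (w e j) ∈? I)

  -- Since no path is entirely coloured in I, each of its vertices coloured in I can
  -- be attached to one end in such a way that neighbours are attached to the same end.
  side : Edge G → Fin (2 + p) → Bool
  side e i = does (run? e i)

  side-start : ∀ e → c (inj₁ (src G e)) ∈ I → side e zero ≡ true
  side-start e q = dec-true (run? e zero) λ { zero _ → q }

  side-end : ∀ e → side e (suc (fromℕ p)) ≡ false
  side-end e = dec-false (run? e (suc (fromℕ p))) λ run → not-full e λ i → run i (Fin.≤fromℕ i)

  -- A run that reaches one vertex extends over the next, because that one is coloured in `I` too.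
  side-step : ∀ e i → c (w e (suc i)) ∈ I → side e (inject₁ i) ≡ side e (suc i)
  side-step e i q = does-⇔ (mk⇔ extend restrict) (run? e (inject₁ i)) (run? e (suc i))
    where
    extend : Run e (inject₁ i) → Run e (suc i)
    extend run j j≤ with m≤n⇒m<n∨m≡n j≤
    ... | inj₁ j< = run j (≤-trans (s≤s⁻¹ j<) (≤-reflexive (sym (Fin.toℕ-inject₁ i))))
    ... | inj₂ eq = subst (λ j → c (w e j) ∈ I) (sym (Fin.toℕ-injective eq)) q
    restrict : Run e (suc i) → Run e (inject₁ i)
    restrict run j j≤ = run j (≤-trans j≤ (≤-trans (≤-reflexive (Fin.toℕ-inject₁ i)) (n≤1+n _)))

  -- Each slot indexes a chain: one for every vertex of G, and for every edge one leg at its source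
  -- (`true`) and one at its target (`false`).
  Slot : Set
  Slot = Vertex G ⊎ (Edge G × Bool)

  finite-Slot : Finite Slot
  finite-Slot = finite-⊎ (Graph.finite G) (finite-× (finite-Edge G) finite-Bool)
    where
    finite-Bool : Finite Bool
    finite-Bool = record { size = 2 ; enum = mk↔ₛ′
      (λ { false → zero ; true → suc zero }) (λ { zero → false ; (suc zero) → true })
      (λ { zero → refl ; (suc zero) → refl }) (λ { false → refl ; true → refl }) }

  anchor : Slot → Vertex G
  anchor (inj₁ v)           = v
  anchor (inj₂ (e , true))  = src G e
  anchor (inj₂ (e , false)) = tgt G e

  colour : Slot → Fin k
  colour s = c (inj₁ (anchor s))

  -- Legs hang from their anchor if it is coloured in `I`; otherwise it is absent from `H` and each
  -- leg is a tree of its own.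
  hub : Slot → Slot
  hub s = if does (colour s ∈? I) then inj₁ (anchor s) else s

  -- A leg repeats no colour, so its vertices can be placed on a chain by their colours,
  -- where the colour δ of the anchor has to come first if it belongs to I.
  order : Fin k → ∀ {γ} → γ ∈ I → Fin ∣ I ∣
  order δ q with δ ∈? I
  ... | yes r = toTop (rank r) (rank q)
  ... | no _  = rank q

  order-injective : ∀ δ {γ γ′} (q : γ ∈ I) (r : γ′ ∈ I) → order δ q ≡ order δ r → γ ≡ γ′
  order-injective δ q r eq with δ ∈? I
  ... | yes a = rank-injective q r (toTop-injective (rank a) eq)
  ... | no _  = rank-injective q r eq

  order-top : ∀ {δ} (q : δ ∈ I) → toℕ (order δ q) ≡ 0
  order-top {δ} q with δ ∈? I
  ... | no ∉  = contradiction q ∉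
  ... | yes r rewrite rank-irrelevant r q = toTop-self (rank q)

  place : Slot → ∀ {γ} → γ ∈ I → Fin ∣ I ∣
  place s = order (colour s)

  open Comb finite-Slot hub ∣ I ∣

  at-vertex : ∀ v i → proj₁ (at (inj₁ v) i) ≡ inj₁ v
  at-vertex v i = cong proj₁ (at-fixed {inj₁ v} i (Bool.if-eta (does (c (inj₁ v) ∈? I))))

  hub-∈ : ∀ s → colour s ∈ I → hub s ≡ inj₁ (anchor s)
  hub-∈ s q = cong (if_then inj₁ (anchor s) else s) (dec-true (colour s ∈? I) q)

  hub-∉ : ∀ s → colour s ∉ I → hub s ≡ s
  hub-∉ s q = cong (if_then inj₁ (anchor s) else s) (dec-false (colour s ∈? I) q)

  place-≢top : ∀ s {γ} (q : γ ∈ I) → colour s ∈ I → γ ≢ colour s → toℕ (place s q) ≢ 0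
  place-≢top s q r γ≢ eq = γ≢ (order-injective (colour s) q r
    (Fin.toℕ-injective (trans eq (sym (order-top r)))))

  at-top : ∀ s (q : colour s ∈ I) → at (inj₁ (anchor s)) (place (inj₁ (anchor s)) q) ≡ at s (place s q)
  at-top s q = at-hub (place s q) (trans (hub-∈ (inj₁ (anchor s)) q) (sym (hub-∈ s q))) (order-top q)

  at-leg : ∀ s {γ} (q : γ ∈ I) → γ ≢ colour s → at s (place s q) ≡ (s , place s q)
  at-leg s q γ≢ = go (colour s ∈? I)
    where
    go : Dec (colour s ∈ I) → at s (place s q) ≡ (s , place s q)
    go (yes r) = at-below {s} (place s q) (place-≢top s q r γ≢)
    go (no ∉)  = at-fixed {s} (place s q) (hub-∉ s ∉)

  slot : SubVertex G p → Slot
  slot (inj₁ v)       = inj₁ v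
  slot (inj₂ (e , j)) = inj₂ (e , side e (suc (inject₁ j)))

  node : ∀ x → c x ∈ I → Node
  node x q = at (slot x) (place (slot x) q)

  leg : Edge G → Bool → ∀ {γ} → γ ∈ I → Node
  leg e b q = at (inj₂ (e , b)) (place (inj₂ (e , b)) q)

  -- The ends of a path have slots of their own, but their nodes coincide with the roots of the
  -- legs. So the whole path can be read along its two legs.
  node-path : ∀ e i {x} (q : c x ∈ I) → w e i ≡ x → node x q ≡ leg e (side e i) q
  node-path e i q refl = go (position G e i) q
    where
    go : ∀ {i x} → Position G e i x → (q : c x ∈ I) → node x q ≡ leg e (side e i) q
    go start     q = trans (at-top (inj₂ (e , true)) q) (cong (λ b → leg e b q) (sym (side-start e q)))
    go (inner j) q = refl {x = leg e (side e (suc (inject₁ j))) q}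
    go end       q = trans (at-top (inj₂ (e , false)) q) (cong (λ b → leg e b q) (sym (side-end e)))

  inner≢anchor : ∀ e j b → c (inj₂ (e , j)) ≢ colour (inj₂ (e , b))
  inner≢anchor e j true  eq
    with () ← rainbow-path e {suc (inject₁ j)} {zero} (trans (cong c (path-inner G e j)) eq)
  inner≢anchor e j false eq = Fin.fromℕ≢inject₁ (sym (Fin.suc-injective
    (rainbow-path e (trans (cong c (path-inner G e j)) (trans eq (sym (cong c (path-end G e))))))))

  -- An inner vertex differs in colour from the anchor, so it is not moved to the hub and its node
  -- still records its edge.
  node-inner : ∀ e j q → let s = slot (inj₂ (e , j)) in node (inj₂ (e , j)) q ≡ (s , place s q)
  node-inner e j q = at-leg (slot (inj₂ (e , j))) q (inner≢anchor e j (side e (suc (inject₁ j))))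

  node-vertex : ∀ v q → proj₁ (node (inj₁ v) q) ≡ inj₁ v
  node-vertex v q = at-vertex v (place (inj₁ v) q)

  node-injective : ∀ {x y} q r → node x q ≡ node y r → x ≡ y
  node-injective {inj₁ u} {inj₁ v} q r eq = cong inj₁ (Sum.inj₁-injective
    (trans (sym (node-vertex u q)) (trans (cong proj₁ eq) (node-vertex v r))))
  node-injective {inj₁ u} {inj₂ (e , j)} q r eq
    with () ← trans (sym (node-vertex u q)) (trans (cong proj₁ eq) (cong proj₁ (node-inner e j r)))
  node-injective {inj₂ (e , j)} {inj₁ u} q r eq
    with () ← trans (sym (node-vertex u r)) (trans (cong proj₁ (sym eq)) (cong proj₁ (node-inner e j q)))
  node-injective {inj₂ (e , i)} {inj₂ (e′ , j)} q r eq =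
    same (cong proj₁ (Sum.inj₂-injective (cong proj₁ eq′)))
         (order-injective (colour (slot (inj₂ (e , i)))) q r
           (trans (cong proj₂ eq′) (cong (λ s → place s r) (sym (cong proj₁ eq′)))))
    where
    eq′ = trans (sym (node-inner e i q)) (trans eq (node-inner e′ j r))
    same : e ≡ e′ → c (inj₂ (e , i)) ≡ c (inj₂ (e′ , j)) → inj₂ (e , i) ≡ inj₂ (e′ , j)
    same refl c≡ = cong (λ i → inj₂ (e , i)) (Fin.inject₁-injective (Fin.suc-injective (rainbow-path e
      (trans (cong c (path-inner G e i)) (trans c≡ (sym (cong c (path-inner G e j))))))))

  -- Neighbours lie on the same side, hence on one chain, and at different places because their
  -- colours differ.
  link-adj : ∀ {x y} (q : c x ∈ I) (r : c y ∈ I) → Link G p x y →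
             Adj (closure comb) (node x q) (node y r)
  link-adj q r ((e , i) , refl , refl) =
    subst₂ (Adj (closure comb)) (sym (node-path e (inject₁ i) q refl)) (sym (node-path e (suc i) r refl))
      (subst (λ b → Adj (closure comb) (leg e b q) (leg e (side e (suc i)) r))
        (sym (side-step e i r))
        (at-adj (inj₂ (e , side e (suc i))) λ eq → i≢1+i (rainbow-path e
          (order-injective (colour (inj₂ (e , side e (suc i)))) q r eq))))
    where
    i≢1+i : ∀ {m} {i : Fin m} → inject₁ i ≢ suc i
    i≢1+i {i = suc i} eq = i≢1+i (Fin.suc-injective eq)

  H⊑comb : H ⊑ closure comb
  H⊑comb = (λ x → node (proj₁ x) (in-I x)) ,
    (λ {x} {y} eq → True-≡ {P? = λ v → c v ∈? I} (node-injective (in-I x) (in-I y) eq)) ,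
    λ {x} {y} → [ link-adj (in-I x) (in-I y) ,
                      Graph.symm (closure comb) {node _ (in-I y)} ∘ link-adj (in-I y) (in-I x) ]′
    where
    in-I : (x : Vertex H) → c (proj₁ x) ∈ I
    in-I (v , t) = toWitness {a? = c v ∈? I} t

  td-H : td H ≤ ∣ I ∣
  td-H = ≤-trans (td≤height H comb H⊑comb) height-comb

-- The upper bound

2+-decompose : ∀ {m n} → 2 + m ≤ n → ∃ λ k → n ≡ 2 + k × m ≤ k
2+-decompose (s≤s (s≤s m≤k)) = _ , refl , m≤k

χ-colourable : ∀ G → Colourable G (χ G)
χ-colourable G = proj₁ (proj₂ (χ-minimum G))

colourable-mono : ∀ {G k l} → k ≤ l → Colourable G k → Colourable G l
colourable-mono k≤l (c , proper) =
  (λ v → inject≤ (c v) k≤l) , λ a eq → proper a (Fin.inject≤-injective k≤l k≤l _ _ eq)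

χ[]-least : ∀ q G {k} → LowTreeDepthColourable q G k → χ[ q ] G ≤ k
χ[]-least q G = proj₂ (proj₂ (χ[]-minimum q G))

module _ (G : Graph) (p : ℕ) where

  rainbow-colouring : ∀ {k} → p ≤ k → Colourable G (2 + k) → ∃ λ (c : SubVertex G p → Fin (2 + k)) →
                      ∀ e → Injective _≡_ _≡_ (c ∘ lookup (path G p e))
  rainbow-colouring {k} p≤k (c , proper) = c′ , λ e →
    path-injective G c′ e (ends e)
      (λ {i} {j} → Fin.inject≤-injective p≤k p≤k i j ∘ Fin.punchIn-injective (punchOut (ends e)) _ _
                     ∘ Fin.punchIn-injective (c (src G e)) _ _)
      (λ i → Fin.punchInᵢ≢i (c (src G e)) _)
      (λ i eq → Fin.punchInᵢ≢i (punchOut (ends e)) (inject≤ i p≤k)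
        (Fin.punchIn-injective (c (src G e)) _ _ (trans eq (sym (Fin.punchIn-punchOut (ends e))))))
    where
    ends : ∀ e → c (src G e) ≢ c (tgt G e)
    ends e = proper (src-adj-tgt G e)
    c′ : SubVertex G p → Fin (2 + k)
    c′ (inj₁ v)       = c v
    -- Skipping the colours of the source and of the target leaves k ≥ p colours, of which the inner
    -- vertices take the first p in order.
    c′ (inj₂ (e , i)) = punchIn (c (src G e)) (punchIn (punchOut (ends e)) (inject≤ i p≤k))

  upper-colouring : ∀ {k} → p ≤ k → Colourable G (2 + k) →
                    LowTreeDepthColourable (suc p) (subdivision G p) (2 + k)
  upper-colouring {k} p≤k col =
    let c , rainbow-path = rainbow-colouring p≤k col
    in c , λ I I≤ → RainbowPaths.td-H G p {2 + k} c rainbow-path I I≤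

  upper-bound : χ[ suc p ] (subdivision G p) ≤ χ G ⊔ (p + 2)
  upper-bound =
    let k , eq , p≤k = 2+-decompose (≤-trans (≤-reflexive (+-comm 2 p)) (m≤n⊔m (χ G) (p + 2)))
        χ≤ = subst (χ G ≤_) eq (m≤m⊔n (χ G) (p + 2))
    in subst (χ[ suc p ] (subdivision G p) ≤_) (sym eq) (χ[]-least (suc p) (subdivision G p)
         (upper-colouring p≤k (colourable-mono {G} χ≤ (χ-colourable G))))

-- Ancestors on paths

module ForestOrder (Y : RootedForest) where
  open RootedForest Y

  -- Ancestors are larger: the roots are the maximal nodes.
  _≺_ _≼_ : Rel Node 0ℓ
  _≺_ = Descends parent
  y ≼ x = y ≡ x ⊎ y ≺ x

  ≺-level : ∀ {y x} → y ≺ x → level x < level y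
  ≺-level = descends-level parent level level-parent

  ≼-trans : ∀ {x y z} → x ≼ y → y ≼ z → x ≼ z
  ≼-trans (inj₁ refl) y≼z         = y≼z
  ≼-trans x≼y         (inj₁ refl) = x≼y
  ≼-trans (inj₂ x≺y)  (inj₂ y≺z)  = inj₂ (x≺y ++⁺ y≺z)

  -- Parents are unique, so the two ways up from `z` agree until one of them stops.
  ≺-comparable : ∀ {x y z} → z ≺ x → z ≺ y → x ≼ y ⊎ y ≼ x
  ≺-comparable [ p ]   [ q ]   = inj₁ (inj₁ (just-injective (trans (sym p) q)))
  ≺-comparable [ p ]   (q ∷ d) =
    inj₁ (inj₂ (subst (_≺ _) (just-injective (trans (sym q) p)) d))
  ≺-comparable (p ∷ d) [ q ]   =
    inj₂ (inj₂ (subst (_≺ _) (just-injective (trans (sym p) q)) d))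
  ≺-comparable (p ∷ d) (q ∷ d′) =
    ≺-comparable d (subst (_≺ _) (just-injective (trans (sym q) p)) d′)

  ≼-comparable : ∀ {x y z} → z ≼ x → z ≼ y → x ≼ y ⊎ y ≼ x
  ≼-comparable (inj₁ refl) z≼y         = inj₁ z≼y
  ≼-comparable z≼x         (inj₁ refl) = inj₂ z≼x
  ≼-comparable (inj₂ z≺x)  (inj₂ z≺y)  = ≺-comparable z≺x z≺y

  ancestor-unique : ∀ {x y z} → z ≺ x → z ≺ y → level x ≡ level y → x ≡ y
  ancestor-unique z≺x z≺y eq with ≺-comparable z≺x z≺y
  ... | inj₁ (inj₁ x≡y) = x≡y
  ... | inj₁ (inj₂ x≺y) = contradiction (≺-level x≺y) (<-irrefl (sym eq))
  ... | inj₂ (inj₁ y≡x) = sym y≡x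
  ... | inj₂ (inj₂ y≺x) = contradiction (≺-level y≺x) (<-irrefl eq)

  -- The first node is compared with the top of the rest. If it lies above the second node, both are
  -- weakly above that node and hence comparable.
  walk-top : ∀ m (f : Fin (suc m) → Node) →
             (∀ i → Adj (closure Y) (f (inject₁ i)) (f (suc i))) → ∃ λ i → ∀ j → f j ≼ f i
  walk-top zero    f adj = zero , λ { zero → inj₁ refl }
  walk-top (suc m) f adj with walk-top m (f ∘ suc) (adj ∘ suc) | adj zero
  ... | i , top | inj₁ f0≺f1 =
    suc i , λ { zero → ≼-trans (inj₂ f0≺f1) (top zero) ; (suc j) → top j }
  ... | i , top | inj₂ f1≺f0 with ≼-comparable (inj₂ f1≺f0) (top zero)
  ...   | inj₁ f0≼fi = suc i , λ { zero → f0≼fi ; (suc j) → top j }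
  ...   | inj₂ fi≼f0 = zero , λ { zero → inj₁ refl ; (suc j) → ≼-trans (top j) fi≼f0 }

  -- One of the adjacent nodes is below the other and both are below `x`, so there are two further
  -- levels under `x`.
  edge-below : ∀ {x y z} → Adj (closure Y) y z → y ≺ x → z ≺ x → 2 + level x ≤ height Y
  edge-below {x} {y} {z} (inj₁ y≺z) _ z≺x =
    ≤-trans (s≤s (≺-level z≺x)) (≤-trans (≺-level y≺z) (level≤height Y y))
  edge-below {x} {y} {z} (inj₂ z≺y) y≺x _ =
    ≤-trans (s≤s (≺-level y≺x)) (≤-trans (≺-level z≺y) (level≤height Y z))

-- Monochromatic edges and the peaks of their paths

record ForestColouring (G : Graph) (p N : ℕ) : Set₁ where
  field
    c         : SubVertex G p → Fin N
    -- The forest for a set is fixed once, so that a level in it has the same meaning for all edges.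
    Y         : Subset N → RootedForest
    embedding : ∀ I → coloursIn (subdivision G p) c I ⊑ closure (Y I)
    shallow   : ∀ I → ∣ I ∣ ≤ suc p → height (Y I) ≤ ∣ I ∣

module Monochromatic (G : Graph) (p : ℕ) {N : ℕ} (F : ForestColouring G p N) where
  open ForestColouring F

  w : Edge G → Fin (2 + p) → SubVertex G p
  w e = lookup (path G p e)

  w-injective : ∀ e → Injective _≡_ _≡_ (w e)
  w-injective e = path-injective G id e
    (λ eq → <-irrefl (cong (toℕ ∘ Finite.index (Graph.finite G)) (Sum.inj₁-injective eq)) (src<tgt G e))
    (λ { refl → refl }) (λ _ ()) (λ _ ())

  node : ∀ I {x} → c x ∈ I → RootedForest.Node (Y I)
  node I {x} q = proj₁ (embedding I) (x , fromWitness {a? = c x ∈? I} q)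

  node-injective : ∀ I {x y} (q : c x ∈ I) (r : c y ∈ I) → node I q ≡ node I r → x ≡ y
  node-injective I q r eq = cong proj₁ (proj₁ (proj₂ (embedding I)) eq)

  node-irrelevant : ∀ I {x} (q r : c x ∈ I) → node I q ≡ node I r
  node-irrelevant I q r = cong (proj₁ (embedding I)) (True-≡ {P? = λ x → c x ∈? I} refl)

  node-adj : ∀ I {x y} (q : c x ∈ I) (r : c y ∈ I) → Adj (subdivision G p) x y →
             Adj (closure (Y I)) (node I q) (node I r)
  node-adj I q r = proj₂ (proj₂ (embedding I))

  Joins : Edge G → Vertex G → Vertex G → Set
  Joins e u v = (src G e ≡ u × tgt G e ≡ v) ⊎ (src G e ≡ v × tgt G e ≡ u)

  -- How the peak of a path from u gives its other end v: the peak is v itself, or it is an inner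
  -- vertex and determines the edge.
  Through : SubVertex G p → Vertex G → Vertex G → Set
  Through (inj₁ x)       u v = x ≡ v
  Through (inj₂ (e , _)) u v = Joins e u v

  through-functional : ∀ x {u v v′} → Through x u v → Through x u v′ → v ≡ v′
  through-functional (inj₁ x) refl refl = refl
  through-functional (inj₂ _) (inj₁ (refl , refl)) (inj₁ (_ , refl))    = refl
  -- In the mixed cases both ends of the edge equal u, and then so do v and v′.
  through-functional (inj₂ _) (inj₁ (refl , refl)) (inj₂ (refl , eq))   = eq
  through-functional (inj₂ _) (inj₂ (refl , refl)) (inj₁ (eq , refl))   = eq
  through-functional (inj₂ _) (inj₂ (refl , refl)) (inj₂ (refl , _))    = refl

  -- An arc from u to v, labelled by the set `I` and the level ℓ of the peak.
  record Below (I : Subset N) (u : Vertex G) (ℓ : ℕ) (v : Vertex G) : Set where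
    constructor below
    open ForestOrder (Y I)
    field
      {top}   : SubVertex G p
      u∈I     : c (inj₁ u) ∈ I
      top∈I   : c top ∈ I
      u≺top   : node I u∈I ≺ node I top∈I
      level≡  : RootedForest.level (Y I) (node I top∈I) ≡ ℓ
      through : Through top u v

  -- The node of u has only one ancestor at level ℓ, and this ancestor determines v.
  below-functional : ∀ {I u ℓ v v′} → Below I u ℓ v → Below I u ℓ v′ → v ≡ v′
  below-functional {I} {u} {v′ = v′} (below {x} q r u≺x l t) (below {y} q′ r′ u≺y l′ t′) =
    through-functional x t (subst (λ z → Through z u v′) (node-injective I r′ r
      (ancestor-unique (subst (_≺ node I r′) (node-irrelevant I q′ q) u≺y) u≺x (trans l′ (sym l)))) t′)
    where open ForestOrder (Y I)

  module Peak (I : Subset N) (I≤ : ∣ I ∣ ≤ suc p) (e : Edge G) (full : ∀ i → c (w e i) ∈ I) where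
    open ForestOrder (Y I)

    private
      f : Fin (2 + p) → RootedForest.Node (Y I)
      f i = node I (full i)

      f-adj : ∀ i → Adj (closure (Y I)) (f (inject₁ i)) (f (suc i))
      f-adj i = node-adj I (full (inject₁ i)) (full (suc i)) (inj₁ ((e , i) , refl , refl))

    topmost : ∃ λ i → ∀ j → f j ≼ f i
    topmost = walk-top (suc p) f f-adj

    peak : Fin (2 + p)
    peak = proj₁ topmost

    peak-level : ℕ
    peak-level = RootedForest.level (Y I) (f peak)

    ≺peak : ∀ {j} → j ≢ peak → f j ≺ f peak
    ≺peak {j} j≢ =
      [ (λ eq → contradiction (w-injective e (node-injective I (full j) (full peak) eq)) j≢) , id ]′
        (proj₂ topmost j)

    peak-shallow : ∀ k → inject₁ k ≢ peak → suc k ≢ peak → 2 + peak-level ≤ ∣ I ∣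
    peak-shallow k ≢₁ ≢₂ = ≤-trans (edge-below (f-adj k) (≺peak ≢₁) (≺peak ≢₂)) (shallow I I≤)

    peak-child : ∀ j → j ≢ peak → suc peak-level ≤ ∣ I ∣
    peak-child j ≢₁ = ≤-trans (≺-level (≺peak ≢₁)) (≤-trans (level≤height (Y I) (f j)) (shallow I I≤))

    peak-level-pos : 1 ≤ peak-level
    peak-level-pos = level-pos (RootedForest.parent (Y I)) (RootedForest.level (Y I))
                       (RootedForest.level-parent (Y I)) (f peak)

    below-src : zero ≢ peak → Below I (src G e) peak-level (tgt G e)
    below-src z≢ = below (full zero) (full peak) (≺peak z≢) refl
      (through (position G e peak) z≢)
      where
      through : ∀ {i x} → Position G e i x → zero ≢ i → Through x (src G e) (tgt G e)
      through start     z≢ = contradiction refl z≢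
      through (inner j) _  = inj₁ (refl , refl)
      through end       _  = refl

    below-tgt : fromℕ (suc p) ≢ peak → Below I (tgt G e) peak-level (src G e)
    below-tgt l≢ = go (full (fromℕ (suc p))) (≺peak l≢) (path-end G e)
      where
      through : ∀ {i x} → Position G e i x → fromℕ (suc p) ≢ i → Through x (tgt G e) (src G e)
      through start     _  = refl
      through (inner j) _  = inj₂ (refl , refl)
      through end       l≢ = contradiction refl l≢
      go : ∀ {x} (q : c x ∈ I) → node I q ≺ f peak → x ≡ inj₁ (tgt G e) →
           Below I (tgt G e) peak-level (src G e)
      go q d refl = below q (full peak) d refl (through (position G e peak) l≢)

  E : Rel (Vertex G) 0ℓ
  E u v = Adj G u v × c (inj₁ u) ≡ c (inj₁ v)

  E? : B.Decidable E
  E? u v = Graph.adj? G u v ×-dec (c (inj₁ u) Fin.≟ c (inj₁ v))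

  E-sym : B.Symmetric E
  E-sym (a , eq) = Graph.symm G a , sym eq

  E-irrefl : B.Irreflexive _≡_ E
  E-irrefl eq (a , _) = Graph.irrefl G eq a

  EColouring : ℕ → Set
  EColouring = Colouring (Graph.finite G) E E? E-sym E-irrefl

  adj⇒joins : ∀ {u v} → Adj G u v → ∃ λ e → Joins e u v
  adj⇒joins {u} {v} a with Fin.<-cmp (Finite.index (Graph.finite G) u) (Finite.index (Graph.finite G) v)
  ... | B.tri< lt _ _ = mkEdge G lt a , inj₁ (refl , refl)
  ... | B.tri≈ _ eq _ = contradiction a (Graph.irrefl G (Finite.index-injective (Graph.finite G) eq))
  ... | B.tri> _ _ gt = mkEdge G gt (Graph.symm G a) , inj₂ (refl , refl)

  full : ∀ e J → c (inj₁ (src G e)) ≡ c (inj₁ (tgt G e)) → (∀ j → c (inj₂ (e , j)) ∈ J) →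
         ∀ i → c (w e i) ∈ ⁅ c (inj₁ (src G e)) ⁆ ∪ J
  full e J mono inJ i = go (position G e i)
    where
    I : Subset N
    I = ⁅ c (inj₁ (src G e)) ⁆ ∪ J
    go : ∀ {i x} → Position G e i x → c x ∈ I
    go start     = x∈p∪q⁺ (inj₁ (x∈⁅x⁆ (c (inj₁ (src G e)))))
    go (inner j) = x∈p∪q⁺ {p = ⁅ c (inj₁ (src G e)) ⁆} (inj₂ (inJ j))
    go end       = subst (_∈ I) mono (go start)

  -- The ends of an edge are separated by `c`, or the edge is monochromatic and they are separated
  -- by `d`.
  combine-colouring : ∀ {k} → EColouring k → Colourable G (N * k)
  combine-colouring (d , proper) = (λ v → combine (c (inj₁ v)) (d v)) , λ {u} {v} a eq →
    let c≡ , d≡ = Fin.combine-injective (c (inj₁ u)) (d u) (c (inj₁ v)) (d v) eq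
    in proper (a , c≡) d≡

  -- A label only has to record `J`, since the remaining colour of the set is that of u.
  From : Subset N → ℕ → Vertex G → Vertex G → Set
  From J ℓ u v = Below (⁅ c (inj₁ u) ⁆ ∪ J) u ℓ v

  module MonochromaticEdge (J : Subset N) (J≤ : ∀ a → ∣ ⁅ a ⁆ ∪ J ∣ ≤ suc p) (e : Edge G)
    (mono : c (inj₁ (src G e)) ≡ c (inj₁ (tgt G e))) (inJ : ∀ j → c (inj₂ (e , j)) ∈ J) where

    I : Subset N
    I = ⁅ c (inj₁ (src G e)) ⁆ ∪ J

    open Peak I (J≤ (c (inj₁ (src G e)))) e (full e J mono inJ) public

    from-src : zero ≢ peak → From J peak-level (src G e) (tgt G e)
    from-src = below-src

    from-tgt : fromℕ (suc p) ≢ peak → From J peak-level (tgt G e) (src G e)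
    -- The two ends share their colour, so they add the same element to `J`.
    from-tgt l≢ = subst (λ a → Below (⁅ a ⁆ ∪ J) (tgt G e) peak-level (src G e)) mono (below-tgt l≢)

  -- An edge is stored in one direction only, so a symmetric property need only be checked from
  -- source to target.
  along : (P : Vertex G → Vertex G → Set) → (∀ {u v} → P u v → P v u) →
    (∀ e → c (inj₁ (src G e)) ≡ c (inj₁ (tgt G e)) → P (src G e) (tgt G e)) → ∀ {u v} → E u v → P u v
  along P P-sym P-edge (a , mono) = go (adj⇒joins a) mono
    where
    go : ∀ {u v} → (∃ λ e → Joins e u v) → c (inj₁ u) ≡ c (inj₁ v) → P u v
    go (e , inj₁ (refl , refl)) mono = P-edge e mono
    go (e , inj₂ (refl , refl)) mono = P-sym (P-edge e (sym mono))

-- Colouring the monochromatic edges for p = 0, p = 1 and p ≥ 2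

private
  -- This needs four vertices: on a path with three, the middle one meets both edges, which is why p
  -- = 1 is treated apart.
  off-edge : ∀ {q} (i : Fin (4 + q)) → ∃ λ k → inject₁ k ≢ i × suc k ≢ i
  off-edge zero          = suc (suc zero) , (λ ()) , λ ()
  off-edge (suc zero)    = suc (suc zero) , (λ ()) , λ ()
  off-edge (suc (suc i)) = zero , (λ ()) , λ ()

  off-edge-or-middle : (i : Fin 3) → (∃ λ k → inject₁ k ≢ i × suc k ≢ i) ⊎ i ≡ suc zero
  off-edge-or-middle zero             = inj₁ (suc zero , (λ ()) , λ ())
  off-edge-or-middle (suc zero)       = inj₂ refl
  off-edge-or-middle (suc (suc zero)) = inj₁ (zero , (λ ()) , λ ())

  other-end : ∀ {m} (i : Fin (2 + m)) → zero ≢ i ⊎ fromℕ (suc m) ≢ i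
  other-end zero    = inj₂ λ ()
  other-end (suc i) = inj₁ λ ()

  other : ∀ {m} (i : Fin (2 + m)) → ∃ λ j → j ≢ i
  other zero    = suc zero , λ ()
  other (suc i) = zero , λ ()

module _ (G : Graph) {N : ℕ} (F : ForestColouring G 0 N) where
  open ForestColouring F using (c)
  open Monochromatic G 0 F

  private
    singleton≤ : (a : Fin N) → ∣ ⁅ a ⁆ ∪ ⊥ ∣ ≤ 1
    singleton≤ a = ≤-trans (∣⁅x⁆∪p∣≤1+∣p∣ a ⊥) (s≤s (≤-reflexive (∣⊥∣≡0 N)))

    -- The two ends use one colour, so the forest has height at most 1, yet one end would lie below
    -- the other.
    absurd-edge : ∀ e → ¬ (c (inj₁ (src G e)) ≡ c (inj₁ (tgt G e)))
    absurd-edge e mono = <⇒≱ (≤-trans (s≤s peak-level-pos)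
      (peak-child (proj₁ (other peak)) (proj₂ (other peak)))) (singleton≤ (c (inj₁ (src G e))))
      where open MonochromaticEdge ⊥ singleton≤ e mono (λ ())

  colouring₀ : EColouring 1
  colouring₀ = (λ _ → zero) , λ e _ →
    along (λ _ _ → Empty.⊥) id absurd-edge e

module _ (G : Graph) {n : ℕ} (F : ForestColouring G 1 (suc n)) where
  open ForestColouring F using (c)
  open Monochromatic G 1 F

  private
    pair≤ : (b a : Fin (suc n)) → ∣ ⁅ a ⁆ ∪ ⁅ b ⁆ ∣ ≤ 2
    pair≤ b a = ≤-trans (∣⁅x⁆∪p∣≤1+∣p∣ a ⁅ b ⁆) (s≤s (≤-reflexive (∣⁅x⁆∣≡1 b)))

    -- The level is always 1 and the colour of the middle vertex is not that of u, which leaves n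
    -- labels.
    Label : Vertex G → Fin n → Vertex G → Set
    Label u ℓ v = From ⁅ punchIn (c (inj₁ u)) ℓ ⁆ 1 u v

    Labelled : Vertex G → Vertex G → Set
    Labelled u v = ∃ λ ℓ → Label u ℓ v

    labelled : ∀ {b u v} → b ≢ c (inj₁ u) → From ⁅ b ⁆ 1 u v → Labelled u v
    labelled {b} {u} {v} b≢ d = punchOut (b≢ ∘ sym) ,
      subst (λ b → From ⁅ b ⁆ 1 u v) (sym (Fin.punchIn-punchOut (b≢ ∘ sym))) d

    both-ways : ∀ e → c (inj₁ (src G e)) ≡ c (inj₁ (tgt G e)) →
                Labelled (src G e) (tgt G e) × Labelled (tgt G e) (src G e)
    both-ways e mono =
      labelled b≢ (subst (λ ℓ → From ⁅ b ⁆ ℓ (src G e) (tgt G e)) level≡1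
        (from-src λ eq → 0≢1 (trans eq middle))) ,
      labelled (b≢ ∘ λ eq → trans eq (sym mono))
               (subst (λ ℓ → From ⁅ b ⁆ ℓ (tgt G e) (src G e)) level≡1
        (from-tgt λ eq → 2≢1 (trans eq middle)))
      where
      b : Fin (suc n)
      b = c (inj₂ (e , zero))
      only-b : ∀ j → c (inj₂ (e , j)) ∈ ⁅ b ⁆
      only-b zero = x∈⁅x⁆ b
      open MonochromaticEdge ⁅ b ⁆ (pair≤ b) e mono only-b
      0≢1 : zero ≢ suc (zero {1})
      0≢1 ()
      2≢1 : suc (suc zero) ≢ suc (zero {1})
      2≢1 ()
      child : suc peak-level ≤ ∣ I ∣
      child = peak-child (proj₁ (other peak)) (proj₂ (other peak))
      level≡1 : peak-level ≡ 1
      level≡1 = ≤-antisym (s≤s⁻¹ (≤-trans child (pair≤ b (c (inj₁ (src G e)))))) peak-level-pos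
      -- An edge avoiding the peak would force three levels, but the height is at most 2.
      middle : peak ≡ suc zero
      middle = [ (λ (k , ≢₁ , ≢₂) → contradiction (≤-trans (s≤s (s≤s peak-level-pos))
                   (≤-trans (peak-shallow k ≢₁ ≢₂) (pair≤ b (c (inj₁ (src G e)))))) λ { (s≤s (s≤s ())) }) ,
                 id ]′ (off-edge-or-middle peak)
      -- Otherwise `I` has one element, while the peak and a vertex below it need two levels.
      b≢ : b ≢ c (inj₁ (src G e))
      b≢ eq = <⇒≱ (≤-trans (s≤s peak-level-pos) child) (≤-reflexive
        (trans (cong (λ b → ∣ ⁅ c (inj₁ (src G e)) ⁆ ∪ ⁅ b ⁆ ∣) eq)
               (trans (cong ∣_∣ (∪-idem ⁅ c (inj₁ (src G e)) ⁆)) (∣⁅x⁆∣≡1 (c (inj₁ (src G e)))))))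

  -- Labels in both directions bound the degrees by n; an orientation alone would cost 2 n + 1
  -- colours.
  colouring₁ : EColouring (suc n)
  colouring₁ = labelled⇒colouring (Graph.finite G) E E? E-sym E-irrefl Label below-functional
    λ e → proj₁ (along (λ u v → Labelled u v × Labelled v u) Product.swap both-ways e)

module _ (G : Graph) {q N : ℕ} (cov : Cover N (2 + q)) (F : ForestColouring G (2 + q) N) where
  open ForestColouring F using (c)
  open Monochromatic G (2 + q) F
  open Cover cov renaming (shallow to deep)

  private
    Label : Vertex G → Fin (size * depth) → Vertex G → Set
    Label u ℓ v = From (set (proj₁ (remQuot depth ℓ))) (suc (toℕ (proj₂ (remQuot {size} depth ℓ)))) u v

    Labelled : Vertex G → Vertex G → Set
    Labelled u v = ∃ λ ℓ → Label u ℓ v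

    labelled : ∀ {u v ℓ} i → 1 ≤ ℓ → 2 + ℓ ≤ 2 + depth → From (set i) ℓ u v → Labelled u v
    labelled {u} {v} {suc ℓ} i _ (s≤s (s≤s ℓ<)) d = combine i (fromℕ< ℓ<) ,
      subst (λ (i , j) → From (set i) (suc (toℕ j)) u v) (sym (Fin.remQuot-combine i (fromℕ< ℓ<)))
        (subst (λ ℓ → From (set i) (suc ℓ) u v) (sym (Fin.toℕ-fromℕ< ℓ<)) d)

    -- The peak is not both ends of the path, so some end lies strictly below it and receives the
    -- arc.
    one-way : ∀ e → c (inj₁ (src G e)) ≡ c (inj₁ (tgt G e)) →
              Labelled (src G e) (tgt G e) ⊎ Labelled (tgt G e) (src G e)
    one-way e mono = Sum.map (labelled i peak-level-pos bound ∘ from-src)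
                             (labelled i peak-level-pos bound ∘ from-tgt) (other-end peak)
      where
      covering = covers λ j → c (inj₂ (e , j))
      i : Fin size
      i = proj₁ covering
      open MonochromaticEdge (set i) (small i) e mono (proj₂ covering)
      bound : 2 + peak-level ≤ 2 + depth
      bound = let k , ≢₁ , ≢₂ = off-edge peak
              in ≤-trans (peak-shallow k ≢₁ ≢₂) (deep i (c (inj₁ (src G e))))

  colouring₂₊ : EColouring (N ^ (2 + q))
  colouring₂₊ = colouring-mono (Graph.finite G) E E? E-sym E-irrefl
    -- With d = `size * depth`, `cheap` says 2 d + 1 ≤ N ^ p, where `2 * d` unfolds to d + (d + 0).
    (subst (λ m → suc (size * depth + m) ≤ N ^ (2 + q)) (+-identityʳ (size * depth)) cheap)
    (orientation⇒colouring (Graph.finite G) E E? E-sym E-irrefl Label below-functional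
      (along (λ u v → Labelled u v ⊎ Labelled v u) Sum.swap one-way))

-- The lower bound

χ-least : ∀ G {k} → Colourable G k → χ G ≤ k
χ-least G = proj₂ (proj₂ (χ-minimum G))

χ[]-attained : ∀ q G → ∃ λ k → k ≡ χ[ q ] G × LowTreeDepthColourable q G k
χ[]-attained q G = proj₁ (χ[]-minimum q G) , refl , proj₁ (proj₂ (χ[]-minimum q G))

td-attained : ∀ G → ClosureHeight G (td G)
td-attained G = proj₁ (proj₂ (td-minimum G))

colourable-power : ∀ p {G N} → ForestColouring G p N → Colourable G (N ^ suc p)
-- Without colours G has no vertices, and 0 ^ (p + 1) reduces to 0.
colourable-power p {N = zero} F =
  (λ v → c (inj₁ v)) , λ {u} _ _ → Fin.¬Fin0 (c (inj₁ u))
  where open ForestColouring F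
colourable-power 0 {G} F = Monochromatic.combine-colouring G 0 F (colouring₀ G F)
colourable-power 1 {G} {suc n} F = Monochromatic.combine-colouring G 1 F
  (subst (Monochromatic.EColouring G 1 F) (sym (*-identityʳ (suc n))) (colouring₁ G F))
colourable-power (suc (suc q)) {G} {suc n} F =
  Monochromatic.combine-colouring G (2 + q) F (colouring₂₊ G (cover n q) F)

optimal-forests : ∀ {p G N} → LowTreeDepthColourable (suc p) (subdivision G p) N → ForestColouring G p N
optimal-forests {p} {G} (c , low) = record
  { c         = c
  ; Y         = λ I → proj₁ (optimal I)
  ; embedding = λ I → proj₂ (proj₂ (optimal I))
  ; shallow   = λ I I≤ → subst (_≤ ∣ I ∣) (sym (proj₁ (proj₂ (optimal I)))) (low I I≤)
  }
  where
  optimal : ∀ I → let H = coloursIn (subdivision G p) c I in ClosureHeight H (td H)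
  optimal I = td-attained (coloursIn (subdivision G p) c I)

lower-bound : ∀ p G → χ G ≤ χ[ suc p ] (subdivision G p) ^ suc p
lower-bound p G =
  let k , eq , colouring = χ[]-attained (suc p) (subdivision G p)
  in subst (λ k → χ G ≤ k ^ suc p) eq
       (χ-least G (colourable-power p {G} (optimal-forests {p} {G} colouring)))

theorem5 : ∀ (p : ℕ) (G : Graph) →
    (χ G ≤ χ[ suc p ] (subdivision G p) ^ suc p)
    × (χ[ suc p ] (subdivision G p) ≤ χ G ⊔ (p + 2))
theorem5 p G = lower-bound p G , upper-bound G p
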